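{- Let $k\ge 2$ be an integer. There exists a set $A\subset \mathbb{N}_0$ such that $A^k + A = \mathbb{N}_0$ and, for some constant $C>0$ and all sufficiently large $X$, $$A(X) \le C\,\frac{\sqrt{X}}{(\log X)^{\alpha(k)}}, \qquad \text{where } \alpha(k) = \frac{k-2}{k+1}.$$
   Context: $\mathbb{N}_0$ is the set of nonnegative integers. For sets $A,B$ of integers, $AB=\{ab: a\in A, b\in B\}$, $A+B=\{a+b\}$, $A^1=A$ and $A^k = A A^{k-1}$ for $k>1$. For $A\subset\mathbb{N}_0$ and $X>0$, $A(X)=|A\cap[1,X]|$. -}

module Defs where

open import Data.Integer.Base using (ℤ; +_; -[1+_])
open import Data.List.Base using (applyUpTo; filter; length)
open import Data.Nat.Base as ℕ using (ℕ; zero; suc; NonZero)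
open import Data.Product.Base using (_×_; ∃-syntax)
open import Data.Rational.Base
  using (ℚ; 0ℚ; 1ℚ; _/_; _+_; _*_; _<_; _≤_; floor; +-*-rawSemiring)
open import Data.Sum.Base using (_⊎_)
open import Level using (0ℓ)
open import Relation.Binary.PropositionalEquality using (_≡_)
open import Relation.Unary using (Pred; Decidable; _∈_; _⊆_; ｛_｝)

open import Algebra.Definitions.RawSemiring +-*-rawSemiring using () renaming (_^_ to _^ℚ_)

------------------------------------------------------------------------
-- Sets of natural numbers

infixl 7 _·ˢ_
infixl 6 _+ˢ_
infixr 8 _^ˢ_

_·ˢ_ : Pred ℕ 0ℓ → Pred ℕ 0ℓ → Pred ℕ 0ℓ
(A ·ˢ B) n = ∃[ a ] ∃[ b ] (a ∈ A × b ∈ B × n ≡ a ℕ.* b)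

_+ˢ_ : Pred ℕ 0ℓ → Pred ℕ 0ℓ → Pred ℕ 0ℓ
(A +ˢ B) n = ∃[ a ] ∃[ b ] (a ∈ A × b ∈ B × n ≡ a ℕ.+ b)

-- The zeroth power is a convention only.
_^ˢ_ : Pred ℕ 0ℓ → ℕ → Pred ℕ 0ℓ
A ^ˢ zero        = ｛ 1 ｝
A ^ˢ suc zero    = A
A ^ˢ suc (suc k) = A ·ˢ (A ^ˢ suc k)

-- |A ∩ [1,X]|.  An integer n lies in [1,X] exactly when 1 ≤ n ≤ ⌊X⌋.
module _ {A : Pred ℕ 0ℓ} (A? : Decidable A) where

  countℤ : ℤ → ℕ
  countℤ (+ n)    = length (filter A? (applyUpTo suc n))
  countℤ -[1+ n ] = 0

  count : ℚ → ℕ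
  count X = countℤ (floor X)

------------------------------------------------------------------------
-- Real numbers as Dedekind cuts
--
-- A real number x is given by the rationals q < x and the rationals
-- q > x.  The cut axioms are not recorded in the type; each operation
-- below yields the cut of the intended real number on the stated domain.

record Cut : Set₁ where
  field
    lower : Pred ℚ 0ℓ
    upper : Pred ℚ 0ℓ

open Cut public

infix  4 _≤ᶜ_
infixl 7 _*ᶜ_ _÷ᶜ_
infixr 8 _^[_/_]

_≤ᶜ_ : Cut → Cut → Set
x ≤ᶜ y = lower x ⊆ lower y

rational : ℚ → Cut
rational p .lower q = q < p
rational p .upper q = p < q

natural : ℕ → Cut
natural n = rational (+ n / 1)

-- The product, for x, y ≥ 0.
_*ᶜ_ : Cut → Cut → Cut
(x *ᶜ y) .lower q =
  q < 0ℚ ⊎ ∃[ a ] ∃[ b ] (a ∈ lower x × b ∈ lower y × 0ℚ ≤ a × 0ℚ ≤ b × q < a * b)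
(x *ᶜ y) .upper q =
  ∃[ a ] ∃[ b ] (a ∈ upper x × b ∈ upper y × a * b < q)

-- The quotient, for x ≥ 0 and y > 0.
_÷ᶜ_ : Cut → Cut → Cut
(x ÷ᶜ y) .lower q =
  q < 0ℚ ⊎ ∃[ a ] ∃[ b ] (a ∈ lower x × b ∈ upper y × 0ℚ ≤ a × q * b < a)
(x ÷ᶜ y) .upper q =
  ∃[ a ] ∃[ b ] (a ∈ upper x × b ∈ lower y × 0ℚ < b × a < q * b)

-- The square root of a rational p ≥ 0.
√ : ℚ → Cut
√ p .lower q = q < 0ℚ ⊎ q * q < p
√ p .upper q = 0ℚ ≤ q × p < q * q

-- The power of x > 0 with exponent m / n: for q ≥ 0, comparing q with
-- x ^ (m / n) is comparing q ^ n with x ^ m.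
_^[_/_] : Cut → ℕ → (n : ℕ) .{{_ : NonZero n}} → Cut
(x ^[ m / n ]) .lower q =
  q < 0ℚ ⊎ ∃[ r ] (r ∈ lower x × 0ℚ ≤ r × q ^ℚ n < r ^ℚ m)
(x ^[ m / n ]) .upper q =
  0ℚ ≤ q × ∃[ r ] (r ∈ upper x × r ^ℚ m < q ^ℚ n)

-- (1 + y / (n + 1)) ^ (n + 1), which for y ≥ 0 is nondecreasing in n and
-- tends to eʸ, strictly from below when y > 0.
euler : ℚ → ℕ → ℚ
euler y n = (1ℚ + y * (+ 1 / suc n)) ^ℚ suc n

-- The exponential of a rational y ≥ 0, as the supremum of euler y.
exp : ℚ → Cut
exp y .lower q = ∃[ n ] q < euler y n
exp y .upper q = ∃[ r ] (r < q × (∀ n → euler y n ≤ r))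

-- The natural logarithm of a rational p ≥ 1: for y ≥ 0, y < log p means
-- eʸ < p, and log p < y means p < eʸ.
log : ℚ → Cut
log p .lower y = y < 0ℚ ⊎ (0ℚ ≤ y × p ∈ upper (exp y))
log p .upper y = 0ℚ ≤ y × p ∈ lower (exp y)

{-# OPTIONS --safe #-}
module Submission where

-- An element of scale p is 1 + (2 ^ p + x) 2 ^ p with x < 2 ^ p; it has size about 4 ^ p and is
-- congruent to 1 modulo 2 ^ p.  If a product of k elements has rapidly growing scales, then its
-- residue modulo 2 ^ p, with p the largest scale, is the product of the other factors, so the
-- product determines its factors.  With 2 ^ p / p ^ α elements at each scale p, where
-- α = (k - 2) / (k + 1), about J ^ (k - 1) choices of scales with sum J give at least
-- 2 ^ J J ^ (k - 1 - k α) products below a multiple of 4 ^ J, up to constants.  A greedy argument of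
-- Lorentz covers the integers of size about 4 ^ J by O(J 2 ^ J / J ^ (k - 1 - k α)) = O(2 ^ J / J ^ α)
-- translates of these products, and the shifts are added to A as well.

open import Defs
open import Data.Bool.Base using (true; false)
open import Data.Integer.Base as ℤ using (-[1+_])
open import Data.Integer.DivMod using (div-pos-is-/ℕ)
import Data.Integer.Properties as ℤ
open import Data.List.Base using (List; []; _∷_; _++_; length; map; concatMap; filter; upTo;
  applyUpTo)
open import Data.List.Membership.Propositional using (find) renaming (_∈_ to _∈ᴸ_)
open import Data.List.Membership.Propositional.Properties using (∈-∃++; ∈-++⁺ˡ; ∈-++⁺ʳ; ∈-++⁻;
  ∈-map⁺; ∈-map⁻; ∈-filter⁺; ∈-filter⁻; ∈-applyUpTo⁺; ∈-applyUpTo⁻; ∈-upTo⁺; ∈-upTo⁻; ∈-concatMap⁻)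
open import Data.List.Properties using (length-++; length-++-sucʳ; length-map; length-upTo;
  length-applyUpTo)
open import Data.List.Relation.Binary.Disjoint.Propositional using (Disjoint)
open import Data.List.Relation.Binary.Subset.Propositional using () renaming (_⊆_ to _⊆ᴸ_)
open import Data.List.Relation.Unary.All as All using (All; []; _∷_)
import Data.List.Relation.Unary.All.Properties as All
open import Data.List.Relation.Unary.AllPairs using ([]; _∷_)
open import Data.List.Relation.Unary.Any as Any using (Any; here; there)
import Data.List.Relation.Unary.Any.Properties as Any
open import Data.List.Relation.Unary.Unique.Propositional using (Unique)
import Data.List.Relation.Unary.Unique.Propositional.Properties as Unique
open import Data.Nat.Base as ℕ using (ℕ; zero; suc; _+_; _*_; _∸_; _^_; _%_; _/_; z≤n; s≤s;
  NonZero) renaming (_≤_ to _≤ℕ_; _<_ to _<ℕ_)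
open import Data.Nat.Coprimality as Coprimality using (1-coprimeTo)
open import Data.Nat.DivMod using (m<n⇒m%n≡m; [m+kn]%n≡m%n; m/n*n≤m; m≡m%n+[m/n]*n; m%n<n;
  m≥n⇒m/n>0)
open import Data.Nat.ListAction using (sum)
import Data.Nat.Properties as ℕ
open import Data.Nat.Tactic.RingSolver using (solve-∀)
open import Data.Product.Base using (_×_; _,_; proj₁; proj₂; Σ-syntax; ∃-syntax)
open import Data.Rational.Base as ℚ using (ℚ; mkℚ; 0ℚ; 1ℚ; _<_; _≤_; *<*; *≤*; floor) renaming
  (_*_ to _*ℚ_; _/_ to _/ℚ_)
import Data.Rational.Properties as ℚ
open import Data.Rational.Unnormalised.Base using (mkℚᵘ; *≡*)
open import Data.Sum.Base using (_⊎_; inj₁; inj₂; [_,_]′)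
open import Data.Unit.Base using (tt)
open import Function.Base using (_∘_)
open import Level using (0ℓ)
open import Relation.Binary.PropositionalEquality using (_≡_; refl; sym; trans; cong; cong₂;
  subst; subst₂; module ≡-Reasoning)
open import Relation.Nullary using (Dec; yes; no; does; contradiction; ¬?)
open import Relation.Nullary.Decidable using (_⊎-dec_)
open import Relation.Unary using (Pred; Decidable; U; _≐_; _∈_)

open import Algebra.Definitions.RawSemiring ℚ.+-*-rawSemiring using () renaming (_^_ to _^ℚ_)
open import Algebra.Properties.CommutativeSemigroup ℕ.+-commutativeSemigroup using (x∙yz≈y∙xz)
open import Data.List.Membership.DecPropositional ℕ._≟_ using (_∈?_)

-- The exponent is a balance. The factor J in the number of translates is the logarithm of the
-- interval length. Thinning every scale by J ^ α costs the set of products J ^ (k α), and the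
-- shifts must still be no more numerous than the elements of their scale. This requires k - 2 - k α
-- ≥ α, and α = (k - 2) / (k + 1) is the largest such value. The difficulty in unique factorisation
-- is that two equal products might have different largest scales. Both are therefore reduced modulo
-- one common power of 2, which divides 2 ^ p for every possible largest scale p and exceeds every
-- possible product of the other factors. This dictates the gaps between the scales. All estimates
-- are made in ℕ by cross-multiplication: J ^ α becomes a power 2 ^ s with integral s, and the
-- exponential decay of the greedy choice becomes repeated halving. The natural logarithm enters
-- only at the end.

bracket : (g : ℕ → ℕ) (l d : ℕ) {n : ℕ} → g l ≤ℕ n → n <ℕ g (d + l) →
          ∃[ m ] (l ≤ℕ m × g m ≤ℕ n × n <ℕ g (suc m))
bracket g l zero    gl≤n n<gl = contradiction gl≤n (ℕ.<⇒≱ n<gl)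
-- The search runs downwards, so the first `m` found with `g m ≤ n` comes with `n < g (suc m)`.
bracket g l (suc d) {n} gl≤n n< with n ℕ.<? g (d + l)
... | yes n<′ = bracket g l d gl≤n n<′
... | no  n≮  = d + l , ℕ.m≤n+m l d , ℕ.≮⇒≥ n≮ , n<

n<2^n : ∀ n → n <ℕ 2 ^ n
n<2^n zero    = s≤s z≤n
n<2^n (suc n) = begin-strict
  suc n          ≡⟨ ℕ.+-comm 1 n ⟩
  n + 1          <⟨ ℕ.+-mono-<-≤ (n<2^n n) (ℕ.m^n>0 2 n) ⟩
  2 ^ n + 2 ^ n  ≡⟨ cong (2 ^ n +_) (ℕ.+-identityʳ (2 ^ n)) ⟨
  2 ^ suc n      ∎
  where open ℕ.≤-Reasoning

-- Counting in finite lists.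

module _ {A : Set} where

  length-mono-⊆ : {xs ys : List A} → Unique xs → xs ⊆ᴸ ys → length xs ≤ℕ length ys
  length-mono-⊆ []              _     = z≤n
  length-mono-⊆ {x ∷ xs} (x∉xs ∷ xs!) xs⊆ys with ∈-∃++ (xs⊆ys (here refl))
  ... | as , bs , refl = begin
    suc (length xs)          ≤⟨ s≤s (length-mono-⊆ xs! xs⊆) ⟩
    suc (length (as ++ bs))  ≡⟨ length-++-sucʳ as x bs ⟨
    length (as ++ x ∷ bs)    ∎
    where
    open ℕ.≤-Reasoning
    xs⊆ : xs ⊆ᴸ as ++ bs
    xs⊆ z∈xs with ∈-++⁻ as (xs⊆ys (there z∈xs))
    ... | inj₁ z∈as         = ∈-++⁺ˡ z∈as
    ... | inj₂ (here refl)  = contradiction refl (All.lookup x∉xs z∈xs)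
    ... | inj₂ (there z∈bs) = ∈-++⁺ʳ as z∈bs

  length-filter-¬ : {P : Pred A 0ℓ} (P? : Decidable P) (xs : List A) →
                    length (filter P? xs) + length (filter (¬? ∘ P?) xs) ≡ length xs
  length-filter-¬ P? []       = refl
  length-filter-¬ P? (x ∷ xs) with ih ← length-filter-¬ P? xs | does (P? x)
  ... | true  = cong suc ih
  ... | false = trans (ℕ.+-suc _ _) (cong suc ih)

module _ {A B : Set} where

  map-Unique⁺ : (f : A → B) {xs : List A} →
                (∀ {x y} → x ∈ᴸ xs → y ∈ᴸ xs → f x ≡ f y → x ≡ y) →
                Unique xs → Unique (map f xs)
  map-Unique⁺ f inj []           = []
  map-Unique⁺ f {x ∷ xs} inj (x∉xs ∷ xs!) =
    All.map⁺ (All.tabulate λ y∈xs fx≡fy →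
      All.lookup x∉xs y∈xs (inj (here refl) (there y∈xs) fx≡fy))
    ∷ map-Unique⁺ f (λ x∈ y∈ → inj (there x∈) (there y∈)) xs!

  concatMap-Unique⁺ : (f : A → List B) {xs : List A} → (∀ {x} → x ∈ᴸ xs → Unique (f x)) →
                      (∀ {x y z} → x ∈ᴸ xs → y ∈ᴸ xs → z ∈ᴸ f x → z ∈ᴸ f y → x ≡ y) →
                      Unique xs → Unique (concatMap f xs)
  concatMap-Unique⁺ f fx! inj []           = []
  concatMap-Unique⁺ f {x ∷ xs} fx! inj (x∉xs ∷ xs!) =
    Unique.++⁺ (fx! (here refl))
      (concatMap-Unique⁺ f (fx! ∘ there) (λ x∈ y∈ → inj (there x∈) (there y∈)) xs!)
      disjoint
    where
    disjoint : Disjoint (f x) (concatMap f xs)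
    disjoint (z∈fx , z∈fxs) with find (∈-concatMap⁻ f z∈fxs)
    ... | y , y∈xs , z∈fy =
      All.lookup x∉xs y∈xs (inj (here refl) (there y∈xs) z∈fx z∈fy)

  -- The factor `c` stands for a division; later it is a power of `2 ^ s`, the loss from thinning.
  length-concatMap-≥ : (f : A → List B) {c d : ℕ} {xs : List A} →
                       (∀ {x} → x ∈ᴸ xs → d ≤ℕ length (f x) * c) →
                       length xs * d ≤ℕ length (concatMap f xs) * c
  length-concatMap-≥ f {xs = []}             d≤ = z≤n
  length-concatMap-≥ f {c} {d} {xs = x ∷ xs} d≤ = begin
    d + length xs * d                                ≤⟨ ℕ.+-mono-≤ (d≤ (here refl)) (length-concatMap-≥ f (d≤ ∘ there)) ⟩
    length (f x) * c + length (concatMap f xs) * c   ≡⟨ ℕ.*-distribʳ-+ c (length (f x)) _ ⟨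
    (length (f x) + length (concatMap f xs)) * c     ≡⟨ cong (_* c) (length-++ (f x)) ⟨
    length (f x ++ concatMap f xs) * c               ∎
    where open ℕ.≤-Reasoning

  module _ {R : A → B → Set} (R? : ∀ a b → Dec (R a b)) where

    degree : List B → A → ℕ
    degree bs a = length (filter (R? a) bs)

    sum-degree-∷ : ∀ b bs as →
      sum (map (degree (b ∷ bs)) as) ≡ length (filter (λ a → R? a b) as) + sum (map (degree bs) as)
    sum-degree-∷ b bs []       = refl
    sum-degree-∷ b bs (a ∷ as) with ih ← sum-degree-∷ b bs as | does (R? a b)
    ... | false = trans (cong (degree bs a +_) ih) (x∙yz≈y∙xz (degree bs a) (length (filter (λ a → R? a b) as)) _)
    ... | true  = cong suc (trans (cong (degree bs a +_) ih) (x∙yz≈y∙xz (degree bs a) (length (filter (λ a → R? a b) as)) _))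

    -- Double counting of the related pairs, of which `sum-degree-∷` splits off those of one `b`.
    sum-degree-≥ : ∀ as {m bs} → (∀ {b} → b ∈ᴸ bs → m ≤ℕ length (filter (λ a → R? a b) as)) →
                   length bs * m ≤ℕ sum (map (degree bs) as)
    sum-degree-≥ as {bs = []}         m≤ = z≤n
    sum-degree-≥ as {m} {b ∷ bs} m≤ = begin
      m + length bs * m                                                    ≤⟨ ℕ.+-mono-≤ (m≤ (here refl)) (sum-degree-≥ as (m≤ ∘ there)) ⟩
      length (filter (λ a → R? a b) as) + sum (map (degree bs) as)  ≡⟨ sum-degree-∷ b bs as ⟨
      sum (map (degree (b ∷ bs)) as)                                       ∎
      where open ℕ.≤-Reasoning

sum≤length*max : {A : Set} (f : A → ℕ) (x : A) (xs : List A) →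
                 ∃[ y ] (y ∈ᴸ x ∷ xs × sum (map f (x ∷ xs)) ≤ℕ length (x ∷ xs) * f y)
sum≤length*max f x []        = x , here refl , ℕ.≤-refl
sum≤length*max f x (x′ ∷ xs) with sum≤length*max f x′ xs
... | y , y∈ , ≤y with ℕ.≤-total (f x) (f y)
...   | inj₁ fx≤fy = y , there y∈ , ℕ.+-mono-≤ fx≤fy ≤y
...   | inj₂ fy≤fx = x , here refl ,
          ℕ.+-monoʳ-≤ (f x) (ℕ.≤-trans ≤y (ℕ.*-monoʳ-≤ (length (x′ ∷ xs)) fy≤fx))

-- Greedy covering by translates.

_translate?_ : (S : List ℕ) (b u : ℕ) → Dec (u ∈ᴸ map (_+ b) S)
(S translate? b) u = u ∈? map (_+ b) S

Covers : List ℕ → List ℕ → Pred ℕ 0ℓ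
Covers S B u = Any (λ b → u ∈ᴸ map (_+ b) S) B

module Greedy (N : ℕ) (S : List ℕ) (S! : Unique S) (S< : ∀ {x} → x ∈ᴸ S → x <ℕ N) where

  InRange : Pred ℕ 0ℓ
  InRange u = N + N ≤ℕ u × u <ℕ 8 * N

  -- As `S` lies in [0, N) and the targets in [2N, 8N), the interval [N, 8N) contains every
  -- difference u - σ. Its lower end keeps the shifts large, which the count of `A` relies on.
  shifts : List ℕ
  shifts = map (N +_) (upTo (7 * N))

  length-shifts : length shifts ≡ 7 * N
  length-shifts = trans (length-map (N +_) (upTo (7 * N))) (length-upTo (7 * N))

  shifts-covering : ∀ {u} → InRange u →
                    length S ≤ℕ length (filter (λ b → (S translate? b) u) shifts)
  shifts-covering {u} (2N≤u , u<8N) = begin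
    length S                                          ≡⟨ length-map (u ∸_) S ⟨
    length (map (u ∸_) S)                             ≤⟨ length-mono-⊆ differences! differences⊆ ⟩
    length (filter (λ b → (S translate? b) u) shifts) ∎
    where
    open ℕ.≤-Reasoning
    σ≤u : ∀ {σ} → σ ∈ᴸ S → σ ≤ℕ u
    σ≤u σ∈S = ℕ.≤-trans (ℕ.<⇒≤ (S< σ∈S)) (ℕ.≤-trans (ℕ.m≤m+n N N) 2N≤u)
    differences! : Unique (map (u ∸_) S)
    differences! = map-Unique⁺ (u ∸_) (λ x∈S y∈S → ℕ.∸-cancelˡ-≡ (σ≤u x∈S) (σ≤u y∈S)) S!
    differences⊆ : map (u ∸_) S ⊆ᴸ filter (λ b → (S translate? b) u) shifts
    differences⊆ b∈ with ∈-map⁻ (u ∸_) b∈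
    ... | σ , σ∈S , refl = ∈-filter⁺ (λ b → (S translate? b) u) u∸σ∈shifts
          (subst (_∈ᴸ map (_+ (u ∸ σ)) S) (ℕ.m+[n∸m]≡n (σ≤u σ∈S)) (∈-map⁺ (_+ (u ∸ σ)) σ∈S))
      where
      N≤u∸σ : N ≤ℕ u ∸ σ
      N≤u∸σ = ℕ.m+n≤o⇒m≤o∸n N (ℕ.≤-trans (ℕ.+-monoʳ-≤ N (ℕ.<⇒≤ (S< σ∈S))) 2N≤u)
      u∸σ∈shifts : u ∸ σ ∈ᴸ shifts
      u∸σ∈shifts = subst (_∈ᴸ shifts) (ℕ.m+[n∸m]≡n N≤u∸σ)
        (∈-map⁺ (N +_) (∈-upTo⁺ (ℕ.+-cancelˡ-< N _ _
          (subst (_<ℕ 8 * N) (sym (ℕ.m+[n∸m]≡n N≤u∸σ)) (ℕ.≤-<-trans (ℕ.m∸n≤m u σ) u<8N)))))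

  uncovered : ℕ → List ℕ → List ℕ
  uncovered b = filter (¬? ∘ (S translate? b))

  -- Averaging: at least |us| |S| incidences are spread over 7N shifts, so some shift covers at
  -- least |us| |S| / 7N elements.
  bestShift : ∀ us → All InRange us → 0 <ℕ N →
              ∃[ b ] (N ≤ℕ b × length (uncovered b us) * (7 * N) + length us * length S ≤ℕ length us * (7 * N))
  bestShift us us∈ 0<N with shifts in eq
  ... | []     = contradiction (trans (sym length-shifts) (cong length eq)) (ℕ.>⇒≢ (ℕ.*-monoʳ-< 7 0<N))
  ... | s ∷ ss with sum≤length*max (degree (S translate?_) us) s ss
  ...   | b , b∈ , ≤b = b , N≤b , (begin
    c̄ * W + length us * length S  ≤⟨ ℕ.+-monoʳ-≤ (c̄ * W) (begin
        length us * length S                                 ≤⟨ sum-degree-≥ (S translate?_) shifts (shifts-covering ∘ All.lookup us∈) ⟩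
        sum (map (degree (S translate?_) us) shifts)         ≡⟨ cong (sum ∘ map (degree (S translate?_) us)) eq ⟩
        sum (map (degree (S translate?_) us) (s ∷ ss))       ≤⟨ ≤b ⟩
        length (s ∷ ss) * c                                  ≡⟨ cong (_* c) (trans (cong length (sym eq)) length-shifts) ⟩
        W * c                                                ∎) ⟩
    c̄ * W + W * c                 ≡⟨ cong (c̄ * W +_) (ℕ.*-comm W c) ⟩
    c̄ * W + c * W                 ≡⟨ ℕ.*-distribʳ-+ W c̄ c ⟨
    (c̄ + c) * W                   ≡⟨ cong (_* W) (trans (ℕ.+-comm c̄ c) (length-filter-¬ ((S translate? b)) us)) ⟩
    length us * W                 ∎)
    where
    open ℕ.≤-Reasoning
    W = 7 * N
    c = degree (S translate?_) us b
    c̄ = length (uncovered b us)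
    N≤b : N ≤ℕ b
    N≤b with ∈-map⁻ (N +_) (subst (b ∈ᴸ_) (sym eq) b∈)
    ... | y , _ , refl = ℕ.m≤m+n N y

  record Partial (us : List ℕ) (t : ℕ) : Set where
    field
      shiftsUsed : List ℕ
      remaining  : List ℕ
      used≥      : All (N ≤ℕ_) shiftsUsed
      used≤      : length shiftsUsed ≤ℕ t
      remaining∈ : All InRange remaining
      covered    : ∀ {u} → u ∈ᴸ us → u ∈ᴸ remaining ⊎ Covers S shiftsUsed u

  open Partial

  done : ∀ {us} → All InRange us → Partial us 0
  done {us} us∈ = record
    { shiftsUsed = [] ; remaining = us ; used≥ = [] ; used≤ = z≤n ; remaining∈ = us∈ ; covered = inj₁ }

  _then_ : ∀ {us t t′} (p : Partial us t) → Partial (remaining p) t′ → Partial us (t + t′)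
  p then q = record
    { shiftsUsed = shiftsUsed p ++ shiftsUsed q
    ; remaining  = remaining q
    ; used≥      = All.++⁺ (used≥ p) (used≥ q)
    ; used≤      = ℕ.≤-trans (ℕ.≤-reflexive (length-++ (shiftsUsed p))) (ℕ.+-mono-≤ (used≤ p) (used≤ q))
    ; remaining∈ = remaining∈ q
    ; covered    = λ u∈us → [ (λ u∈r → [ inj₁ , inj₂ ∘ Any.++⁺ʳ (shiftsUsed p) ]′ (covered q u∈r))
                            , inj₂ ∘ Any.++⁺ˡ ]′ (covered p u∈us)
    }

  single : ∀ {us} → All InRange us → (b : ℕ) → N ≤ℕ b → Partial us 1
  single {us} us∈ b N≤b = record
    { shiftsUsed = b ∷ []
    ; remaining  = uncovered b us
    ; used≥      = N≤b ∷ []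
    ; used≤      = s≤s z≤n
    ; remaining∈ = All.filter⁺ (¬? ∘ (S translate? b)) us∈
    ; covered    = split
    }
    where
    split : ∀ {u} → u ∈ᴸ us → u ∈ᴸ uncovered b us ⊎ Covers S (b ∷ []) u
    split {u} u∈us with (S translate? b) u
    ... | yes u∈b+S = inj₂ (here u∈b+S)
    ... | no  u∉b+S = inj₁ (∈-filter⁺ (¬? ∘ (S translate? b)) u∈us u∉b+S)

  module _ (0<N : 0 <ℕ N) where

    -- As long as r elements remain, every step covers at least r |S| / 7N of them.
    steps : ∀ t {us} → All InRange us →
            Σ[ p ∈ Partial us t ] (length (remaining p) ≤ℕ length us ×
              length (remaining p) * (7 * N + t * length S) ≤ℕ length us * (7 * N))
    steps zero    {us} us∈ = done us∈ , ℕ.≤-refl , ℕ.≤-reflexive (cong (length us *_) (ℕ.+-identityʳ (7 * N)))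
    steps (suc t) {us} us∈ with bestShift us us∈ 0<N
    ... | b , N≤b , ≤us with steps t (remaining∈ (single us∈ b N≤b))
    ...   | p , p≤ , r≤ = (single us∈ b N≤b then p) , r≤us , (begin
      r * (W + (m + t * m))          ≡⟨ rearrange r W m (t * m) ⟩
      r * (W + t * m) + r * m        ≤⟨ ℕ.+-mono-≤ r≤ (ℕ.*-monoˡ-≤ m r≤us) ⟩
      length us′ * W + length us * m ≤⟨ ≤us ⟩
      length us * W                  ∎)
      where
      open ℕ.≤-Reasoning
      W = 7 * N
      m = length S
      us′ = uncovered b us
      r = length (remaining p)
      r≤us : r ≤ℕ length us
      r≤us = ℕ.≤-trans p≤ (ℕ.≤-trans (ℕ.m≤n+m (length us′) _)
               (ℕ.≤-reflexive (length-filter-¬ (S translate? b) us)))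
      rearrange : ∀ r W m tm → r * (W + (m + tm)) ≡ r * (W + tm) + r * m
      rearrange = solve-∀

    module _ (T : ℕ) (W≤Tm : 7 * N ≤ℕ T * length S) where

      -- Since T |S| ≥ 7N, the factor `7 * N + T * length S` in `steps` is at least twice 7N.
      -- Iterating this replaces an estimate of (1 - |S| / 7N) ^ t by an exponential.
      halve : ∀ {us} → All InRange us → Σ[ p ∈ Partial us T ] length (remaining p) * 2 ≤ℕ length us
      halve {us} us∈ with steps T us∈
      ... | p , _ , r≤ = p , ℕ.*-cancelʳ-≤ (r * 2) (length us) (7 * N) {{ℕ.>-nonZero (ℕ.*-monoʳ-< 7 0<N)}} (begin
        r * 2 * W               ≡⟨ double r W ⟩
        r * (W + W)             ≤⟨ ℕ.*-monoʳ-≤ r (ℕ.+-monoʳ-≤ W W≤Tm) ⟩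
        r * (W + T * length S)  ≤⟨ r≤ ⟩
        length us * W           ∎)
        where
        open ℕ.≤-Reasoning
        W = 7 * N
        r = length (remaining p)
        double : ∀ r W → r * 2 * W ≡ r * (W + W)
        double = solve-∀

      halvings : ∀ h {us} → All InRange us →
                 Σ[ p ∈ Partial us (h * T) ] length (remaining p) * 2 ^ h ≤ℕ length us
      halvings zero    {us} us∈ = done us∈ , ℕ.≤-reflexive (ℕ.*-identityʳ (length us))
      halvings (suc h) {us} us∈ with halve us∈
      ... | p , p≤ with halvings h (remaining∈ p)
      ...   | q , q≤ = (p then q) , (begin
        r * (2 * 2 ^ h)             ≡⟨ rearrange r (2 ^ h) ⟩
        r * 2 ^ h * 2               ≤⟨ ℕ.*-monoˡ-≤ 2 q≤ ⟩
        length (remaining p) * 2    ≤⟨ p≤ ⟩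
        length us                   ∎)
        where
        open ℕ.≤-Reasoning
        r = length (remaining q)
        rearrange : ∀ r x → r * (2 * x) ≡ r * x * 2
        rearrange = solve-∀

singletonCover : ∀ N σ S us → σ ∈ᴸ S → σ <ℕ N → All (N + N ≤ℕ_) us →
                 Σ[ B ∈ List ℕ ] (All (N ≤ℕ_) B × length B ≡ length us × (∀ {u} → u ∈ᴸ us → Covers S B u))
singletonCover N σ S us σ∈S σ<N us≥ =
  map (_∸ σ) us , All.map⁺ (All.map N≤ us≥) , length-map (_∸ σ) us ,
  λ {u} u∈us → Any.map⁺ (Any.map (λ where refl → u∈ (All.lookup us≥ u∈us)) u∈us)
  where
  N≤ : ∀ {u} → N + N ≤ℕ u → N ≤ℕ u ∸ σ
  N≤ 2N≤u = ℕ.m+n≤o⇒m≤o∸n N (ℕ.≤-trans (ℕ.+-monoʳ-≤ N (ℕ.<⇒≤ σ<N)) 2N≤u)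
  u∈ : ∀ {u} → N + N ≤ℕ u → u ∈ᴸ map (_+ (u ∸ σ)) S
  u∈ {u} 2N≤u = subst (_∈ᴸ map (_+ (u ∸ σ)) S)
    (ℕ.m+[n∸m]≡n (ℕ.≤-trans (ℕ.<⇒≤ σ<N) (ℕ.≤-trans (ℕ.m≤m+n N N) 2N≤u))) (∈-map⁺ (_+ (u ∸ σ)) σ∈S)

-- Lorentz's additive complement: greedy halving, then one shift for each of the at most T
-- elements that are still uncovered.
additiveComplement : ∀ N T h (S : List ℕ) → 0 <ℕ N → Unique S → (∀ {x} → x ∈ᴸ S → x <ℕ N) →
  7 * N ≤ℕ T * length S → 6 * N ≤ℕ T * 2 ^ h →
  Σ[ B ∈ List ℕ ] (All (N ≤ℕ_) B × length B ≤ℕ suc h * T ×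
    (∀ {n} → N + N ≤ℕ n → n <ℕ 8 * N → Covers S B n))
additiveComplement N T h []      0<N S! S< W≤ N≤ =
  contradiction (ℕ.≤-trans W≤ (ℕ.≤-reflexive (ℕ.*-zeroʳ T))) (ℕ.<⇒≱ (ℕ.*-monoʳ-< 7 0<N))
additiveComplement N T h S@(σ ∷ _) 0<N S! S< W≤ N≤ = proof
  where
  open Greedy N S S! S<
  open Partial
  open ℕ.≤-Reasoning
  target : List ℕ
  target = applyUpTo ((N + N) +_) (6 * N)
  8N : ∀ N → (N + N) + 6 * N ≡ 8 * N
  8N = solve-∀
  target∈ : All InRange target
  target∈ = All.applyUpTo⁺₁ ((N + N) +_) (6 * N) λ {i} i<6N →
    ℕ.m≤m+n (N + N) i , subst ((N + N) + i <ℕ_) (8N N) (ℕ.+-monoʳ-< (N + N) i<6N)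
  p : Partial target (h * T)
  p = proj₁ (halvings 0<N T W≤ h target∈)
  remaining≤T : length (remaining p) ≤ℕ T
  remaining≤T = ℕ.*-cancelʳ-≤ _ T (2 ^ h) {{ℕ.m^n≢0 2 h}} (begin
    length (remaining p) * 2 ^ h  ≤⟨ proj₂ (halvings 0<N T W≤ h target∈) ⟩
    length target                 ≡⟨ length-applyUpTo ((N + N) +_) (6 * N) ⟩
    6 * N                         ≤⟨ N≤ ⟩
    T * 2 ^ h                     ∎)
  ∈target : ∀ {n} → N + N ≤ℕ n → n <ℕ 8 * N → n ∈ᴸ target
  ∈target {n} 2N≤n n<8N = subst (_∈ᴸ target) (ℕ.m+[n∸m]≡n 2N≤n) (∈-applyUpTo⁺ ((N + N) +_)
    (ℕ.+-cancelˡ-< (N + N) _ _ (subst₂ _<ℕ_ (sym (ℕ.m+[n∸m]≡n 2N≤n)) (sym (8N N)) n<8N)))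
  proof : Σ[ B ∈ List ℕ ] (All (N ≤ℕ_) B × length B ≤ℕ suc h * T ×
            (∀ {n} → N + N ≤ℕ n → n <ℕ 8 * N → Covers S B n))
  proof with singletonCover N σ S (remaining p) (here refl) (S< (here refl)) (All.map proj₁ (remaining∈ p))
  ... | B , B≥ , |B| , coversB = shiftsUsed p ++ B , All.++⁺ (used≥ p) B≥ , (begin
      length (shiftsUsed p ++ B)                    ≡⟨ length-++ (shiftsUsed p) ⟩
      length (shiftsUsed p) + length B              ≤⟨ ℕ.+-mono-≤ (used≤ p) (ℕ.≤-trans (ℕ.≤-reflexive |B|) remaining≤T) ⟩
      h * T + T                                     ≡⟨ ℕ.+-comm (h * T) T ⟩
      suc h * T                                     ∎)
    , λ 2N≤n n<8N → [ Any.++⁺ʳ (shiftsUsed p) ∘ coversB , Any.++⁺ˡ ]′ (covered p (∈target 2N≤n n<8N))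

-- Elements of one scale.

element : ℕ → ℕ → ℕ
element p x = suc ((2 ^ p + x) * 2 ^ p)

element-injective : ∀ p {x y} → element p x ≡ element p y → x ≡ y
element-injective p {x} {y} eq = ℕ.+-cancelˡ-≡ (2 ^ p) x y
  (ℕ.*-cancelʳ-≡ (2 ^ p + x) (2 ^ p + y) (2 ^ p) {{ℕ.m^n≢0 2 p}} (ℕ.suc-injective eq))

element> : ∀ p x → 2 ^ (p + p) <ℕ element p x
element> p x = s≤s (begin
  2 ^ (p + p)          ≡⟨ ℕ.^-distribˡ-+-* 2 p p ⟩
  2 ^ p * 2 ^ p        ≤⟨ ℕ.*-monoˡ-≤ (2 ^ p) (ℕ.m≤m+n (2 ^ p) x) ⟩
  (2 ^ p + x) * 2 ^ p  ∎)
  where open ℕ.≤-Reasoning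

element≤ : ∀ p {x} → x <ℕ 2 ^ p → element p x ≤ℕ 2 ^ suc (p + p)
element≤ p {x} x<2^p = begin
  suc ((2 ^ p + x) * 2 ^ p)      ≤⟨ ℕ.+-monoˡ-≤ _ (ℕ.m^n>0 2 p) ⟩
  2 ^ p + (2 ^ p + x) * 2 ^ p    ≡⟨ regroup (2 ^ p) x ⟩
  (2 ^ p + suc x) * 2 ^ p        ≤⟨ ℕ.*-monoˡ-≤ (2 ^ p) (ℕ.+-monoʳ-≤ (2 ^ p) x<2^p) ⟩
  (2 ^ p + 2 ^ p) * 2 ^ p        ≡⟨ double (2 ^ p) ⟩
  2 * (2 ^ p * 2 ^ p)            ≡⟨ cong (2 *_) (ℕ.^-distribˡ-+-* 2 p p) ⟨
  2 ^ suc (p + p)                ∎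
  where
  open ℕ.≤-Reasoning
  regroup : ∀ q x → q + (q + x) * q ≡ (q + suc x) * q
  regroup = solve-∀
  double : ∀ q → (q + q) * q ≡ 2 * (q * q)
  double = solve-∀

-- Elements of scale p lie in (4 ^ p, 2 · 4 ^ p], and these intervals are disjoint. The summand
-- `2 ^ p` in `element` provides the lower end.
element-scale-≤ : ∀ {p p′ x x′} → x <ℕ 2 ^ p → element p x ≡ element p′ x′ → p′ ≤ℕ p
element-scale-≤ {p} {p′} {x} {x′} x< eq with p′ ℕ.≤? p
... | yes p′≤p = p′≤p
... | no  p′≰p = contradiction eq (ℕ.<⇒≢ (begin-strict
  element p x        ≤⟨ element≤ p x< ⟩
  2 ^ suc (p + p)    ≤⟨ ℕ.^-monoʳ-≤ 2 (ℕ.+-mono-≤ (ℕ.≰⇒> p′≰p) (ℕ.<⇒≤ (ℕ.≰⇒> p′≰p))) ⟩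
  2 ^ (p′ + p′)      <⟨ element> p′ x′ ⟩
  element p′ x′      ∎))
  where open ℕ.≤-Reasoning

element-scale-injective : ∀ {p p′ x x′} → x <ℕ 2 ^ p → x′ <ℕ 2 ^ p′ → element p x ≡ element p′ x′ → p ≡ p′
element-scale-injective x< x′< eq = ℕ.≤-antisym (element-scale-≤ x′< (sym eq)) (element-scale-≤ x< eq)

-- An element of scale p is 1 modulo 2 ^ p, hence modulo 2 ^ q. A separate q lets products with
-- different p share a modulus.
element-mod : ∀ {p q} x r → q ≤ℕ p → r <ℕ 2 ^ q → (element p x * r % 2 ^ q) {{ℕ.m^n≢0 2 q}} ≡ r
element-mod {p} {q} x r q≤p r< = begin
  element p x * r % Q                     ≡⟨ cong (λ z → suc ((2 ^ p + x) * z) * r % Q) 2^p ⟩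
  suc ((2 ^ p + x) * (2 ^ (p ∸ q) * Q)) * r % Q   ≡⟨ cong (_% Q) (rearrange (2 ^ p + x) (2 ^ (p ∸ q)) Q r) ⟩
  (r + (2 ^ p + x) * 2 ^ (p ∸ q) * r * Q) % Q     ≡⟨ [m+kn]%n≡m%n r ((2 ^ p + x) * 2 ^ (p ∸ q) * r) Q ⟩
  r % Q                                   ≡⟨ m<n⇒m%n≡m r< ⟩
  r                                       ∎
  where
  open ≡-Reasoning
  Q = 2 ^ q
  instance _ = ℕ.m^n≢0 2 q
  2^p : 2 ^ p ≡ 2 ^ (p ∸ q) * Q
  2^p = trans (cong (2 ^_) (sym (ℕ.m∸n+n≡m q≤p))) (ℕ.^-distribˡ-+-* 2 (p ∸ q) q)
  rearrange : ∀ a b c r → suc (a * (b * c)) * r ≡ r + a * b * r * c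
  rearrange = solve-∀

-- The product is r modulo 2 ^ q, so it determines the small factor and then the large one.
element-product-injective : ∀ {p p′ q x x′ r r′} → q ≤ℕ p → q ≤ℕ p′ → r <ℕ 2 ^ q → r′ <ℕ 2 ^ q →
  0 <ℕ r → element p x * r ≡ element p′ x′ * r′ → r ≡ r′ × element p x ≡ element p′ x′
element-product-injective {p} {p′} {q} {x} {x′} {r} {r′} q≤p q≤p′ r< r′< 0<r eq = r≡r′ ,
  ℕ.*-cancelʳ-≡ _ _ r {{ℕ.>-nonZero 0<r}} (trans eq (cong (element p′ x′ *_) (sym r≡r′)))
  where
  r≡r′ : r ≡ r′
  r≡r′ = trans (sym (element-mod x r q≤p r<))
           (trans (cong (λ z → (z % 2 ^ q) {{ℕ.m^n≢0 2 q}}) eq) (element-mod x′ r′ q≤p′ r′<))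

-- Products with rapidly growing scales.

n<8^n : ∀ n → n <ℕ 8 ^ n
n<8^n n = ℕ.<-≤-trans (n<2^n n) (ℕ.^-monoˡ-≤ n (s≤s (s≤s z≤n)))

-- Here products i J has suc i factors, of total scale J.  The factor 8 between the ranges of the
-- scales keeps the product of the smaller factors below 2 ^ p, where p is the largest scale.
module Products (s L : ℕ) where

  -- Every scale is thinned by the same `s`. For p ≤ s the truncated subtraction leaves one element,
  -- so the lower bound in `length-block` survives.
  block : ℕ → List ℕ
  block p = upTo (2 ^ (p ∸ s))

  -- These are not scales of single factors but the totals j allowed for the i + 1 smaller factors
  -- together; the next factor takes the rest J - j.
  scales : ℕ → List ℕ
  scales i = map (8 ^ i * L +_) (upTo L)

  products : ℕ → ℕ → List ℕ
  multiples : ℕ → ℕ → List ℕ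

  products zero    J = map (element J) (block J)
  products (suc i) J = concatMap (λ j → concatMap (multiples (J ∸ j)) (products i j)) (scales i)

  multiples p r = map (λ x → element p x * r) (block p)

  block< : ∀ {p x} → x ∈ᴸ block p → x <ℕ 2 ^ p
  block< {p} x∈ = ℕ.<-≤-trans (∈-upTo⁻ x∈) (ℕ.^-monoʳ-≤ 2 (ℕ.m∸n≤m p s))

  ∈-products⁻ : ∀ i J {n} → n ∈ᴸ products (suc i) J →
    ∃[ j ] ∃[ r ] ∃[ x ] (j ∈ᴸ scales i × r ∈ᴸ products i j × x ∈ᴸ block (J ∸ j) × n ≡ element (J ∸ j) x * r)
  ∈-products⁻ i J n∈ with find (∈-concatMap⁻ _ {xs = scales i} n∈)
  ... | j , j∈ , n∈′ with find (∈-concatMap⁻ (multiples (J ∸ j)) {xs = products i j} n∈′)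
  ...   | r , r∈ , n∈″ with ∈-map⁻ (λ x → element (J ∸ j) x * r) n∈″
  ...     | x , x∈ , eq = j , r , x , j∈ , r∈ , x∈ , eq

  module _ (i : ℕ) {j : ℕ} (j∈ : j ∈ᴸ scales i) where

    scales≥ : 8 ^ i * L ≤ℕ j
    scales≥ with ∈-map⁻ (8 ^ i * L +_) j∈
    ... | y , _ , refl = ℕ.m≤m+n (8 ^ i * L) y

    scales< : j <ℕ 2 * (8 ^ i * L)
    scales< with ∈-map⁻ (8 ^ i * L +_) j∈
    ... | y , y∈ , refl = ℕ.+-monoʳ-< (8 ^ i * L) (begin-strict
      y              <⟨ ∈-upTo⁻ y∈ ⟩
      L              ≤⟨ ℕ.m≤n*m L (8 ^ i) {{ℕ.m^n≢0 8 i}} ⟩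
      8 ^ i * L      ≡⟨ ℕ.+-identityʳ (8 ^ i * L) ⟨
      8 ^ i * L + 0  ∎)
      where open ℕ.≤-Reasoning

    module _ {J : ℕ} (≤J : 8 ^ suc i * L ≤ℕ J) where

      private
        8≤J : 8 * (8 ^ i * L) ≤ℕ J
        8≤J = ℕ.≤-trans (ℕ.≤-reflexive (sym (ℕ.*-assoc 8 (8 ^ i) L))) ≤J

      scales≤ : j ≤ℕ J
      scales≤ = ℕ.≤-trans (ℕ.<⇒≤ scales<) (ℕ.≤-trans (ℕ.*-monoˡ-≤ (8 ^ i * L) {2} {8} (s≤s (s≤s z≤n))) 8≤J)

      -- The ratio 8 splits as 2 + 6: the smaller factors use less than 2M of the total 8M, where M
      -- = 8 ^ i L.
      top≥ : 6 * (8 ^ i * L) ≤ℕ J ∸ j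
      top≥ = ℕ.m+n≤o⇒m≤o∸n (6 * M) (begin
        6 * M + j      ≤⟨ ℕ.+-monoʳ-≤ (6 * M) (ℕ.<⇒≤ scales<) ⟩
        6 * M + 2 * M  ≡⟨ ℕ.*-distribʳ-+ M 6 2 ⟨
        8 * M          ≤⟨ 8≤J ⟩
        J              ∎)
        where
        open ℕ.≤-Reasoning
        M = 8 ^ i * L

  -- Each of the i + 1 factors is at most 2 · 4 ^ p, and the scales p add up to J.
  products-bounds : ∀ i {J n} → 8 ^ i * L ≤ℕ J → n ∈ᴸ products i J → 0 <ℕ n × n ≤ℕ 2 ^ (suc i + (J + J))
  products-bounds zero    {J} _  n∈ with ∈-map⁻ (element J) n∈
  ... | x , x∈ , refl = s≤s z≤n , element≤ J (block< x∈)
  products-bounds (suc i) {J} ≤J n∈ with ∈-products⁻ i J n∈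
  ... | j , r , x , j∈ , r∈ , x∈ , refl with products-bounds i (scales≥ i j∈) r∈
  ...   | 0<r , r≤ = ℕ.*-mono-< {0} {element (J ∸ j) x} (s≤s z≤n) 0<r , (begin
    element p x * r                              ≤⟨ ℕ.*-mono-≤ (element≤ p (block< x∈)) r≤ ⟩
    2 ^ suc (p + p) * 2 ^ (suc i + (j + j))      ≡⟨ ℕ.^-distribˡ-+-* 2 (suc (p + p)) _ ⟨
    2 ^ (suc (p + p) + (suc i + (j + j)))        ≡⟨ cong (2 ^_) (regroup p i j) ⟩
    2 ^ (suc (suc i) + ((p + j) + (p + j)))      ≡⟨ cong (λ z → 2 ^ (suc (suc i) + (z + z))) (ℕ.m∸n+n≡m (scales≤ i j∈ ≤J)) ⟩
    2 ^ (suc (suc i) + (J + J))                  ∎)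
    where
    open ℕ.≤-Reasoning
    p = J ∸ j
    regroup : ∀ p i j → suc (p + p) + (suc i + (j + j)) ≡ suc (suc i) + ((p + j) + (p + j))
    regroup = solve-∀

  module _ (0<L : 0 <ℕ L) where

    -- The exponent i + 1 + 2j is less than M + 4M, which stays within the 6M of `top≥`.
    small-factor : ∀ i {j r} → j ∈ᴸ scales i → r ∈ᴸ products i j → r <ℕ 2 ^ (6 * (8 ^ i * L))
    small-factor i {j} {r} j∈ r∈ = begin-strict
      r                       ≤⟨ proj₂ (products-bounds i (scales≥ i j∈) r∈) ⟩
      2 ^ (suc i + (j + j))   <⟨ ℕ.^-monoʳ-< 2 (s≤s (s≤s z≤n)) exponent< ⟩
      2 ^ (6 * M)             ∎
      where
      open ℕ.≤-Reasoning
      M = 8 ^ i * L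
      6M : ∀ M → M + (2 * M + 2 * M) ≤ℕ 6 * M
      6M M = ℕ.≤-trans (ℕ.m≤n+m _ M) (ℕ.≤-reflexive (eq M))
        where
        eq : ∀ M → M + (M + (2 * M + 2 * M)) ≡ 6 * M
        eq = solve-∀
      exponent< : suc i + (j + j) <ℕ 6 * M
      exponent< = begin-strict
        suc i + (j + j)        <⟨ ℕ.+-mono-≤-< (ℕ.≤-trans (n<8^n i) (ℕ.m≤m*n (8 ^ i) L {{ℕ.>-nonZero 0<L}})) (ℕ.+-mono-< (scales< i j∈) (scales< i j∈)) ⟩
        M + (2 * M + 2 * M)    ≤⟨ 6M M ⟩
        6 * M                  ∎

    products-Unique : ∀ i {J} → 8 ^ i * L ≤ℕ J → Unique (products i J)
    products-Unique zero    {J} _  = Unique.map⁺ (element-injective J) (Unique.upTo⁺ _)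
    products-Unique (suc i) {J} ≤J = concatMap-Unique⁺ _
      (λ {j} j∈ → concatMap-Unique⁺ (multiples (J ∸ j))
        (λ {r} r∈ → Unique.map⁺
          (λ eq → element-injective (J ∸ j) (ℕ.*-cancelʳ-≡ _ _ r {{ℕ.>-nonZero (positive j∈ r∈)}} eq))
          (Unique.upTo⁺ _))
        (λ {r} {r′} r∈ r′∈ z∈ z∈′ → factor j∈ j∈ r∈ r′∈ z∈ z∈′)
        (products-Unique i (scales≥ i j∈)))
      (λ {j} {j′} j∈ j′∈ z∈ z∈′ → scale j∈ j′∈ z∈ z∈′)
      (Unique.map⁺ (ℕ.+-cancelˡ-≡ (8 ^ i * L) _ _) (Unique.upTo⁺ L))
      where
      positive : ∀ {j r} → j ∈ᴸ scales i → r ∈ᴸ products i j → 0 <ℕ r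
      positive j∈ r∈ = proj₁ (products-bounds i (scales≥ i j∈) r∈)

      -- The common modulus is 2 ^ (6M): by `top≥` both large factors are 1 modulo it, and by
      -- `small-factor` both cofactors are below it. Once the cofactors agree, the size of the large
      -- factor gives its scale.
      both : ∀ {j j′ r r′ z} → j ∈ᴸ scales i → j′ ∈ᴸ scales i → r ∈ᴸ products i j → r′ ∈ᴸ products i j′ →
             z ∈ᴸ multiples (J ∸ j) r → z ∈ᴸ multiples (J ∸ j′) r′ → r ≡ r′ × J ∸ j ≡ J ∸ j′
      both {j} {j′} {r} {r′} j∈ j′∈ r∈ r′∈ z∈ z∈′
        with ∈-map⁻ (λ x → element (J ∸ j) x * r) z∈ | ∈-map⁻ (λ x → element (J ∸ j′) x * r′) z∈′
      ... | x , x∈ , refl | x′ , x′∈ , eq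
        with element-product-injective (top≥ i j∈ ≤J) (top≥ i j′∈ ≤J) (small-factor i j∈ r∈) (small-factor i j′∈ r′∈) (positive j∈ r∈) eq
      ...   | r≡r′ , e≡e′ = r≡r′ , element-scale-injective (block< x∈) (block< x′∈) e≡e′

      factor : ∀ {j j′ r r′ z} → j ∈ᴸ scales i → j′ ∈ᴸ scales i → r ∈ᴸ products i j → r′ ∈ᴸ products i j′ →
               z ∈ᴸ multiples (J ∸ j) r → z ∈ᴸ multiples (J ∸ j′) r′ → r ≡ r′
      factor j∈ j′∈ r∈ r′∈ z∈ z∈′ = proj₁ (both j∈ j′∈ r∈ r′∈ z∈ z∈′)

      scale : ∀ {j j′ z} → j ∈ᴸ scales i → j′ ∈ᴸ scales i →
              z ∈ᴸ concatMap (multiples (J ∸ j)) (products i j) →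
              z ∈ᴸ concatMap (multiples (J ∸ j′)) (products i j′) → j ≡ j′
      scale {j} {j′} j∈ j′∈ z∈ z∈′
        with find (∈-concatMap⁻ (multiples (J ∸ j)) {xs = products i j} z∈)
           | find (∈-concatMap⁻ (multiples (J ∸ j′)) {xs = products i j′} z∈′)
      ... | r , r∈ , z∈r | r′ , r′∈ , z∈r′ =
        ℕ.∸-cancelˡ-≡ (scales≤ i j∈ ≤J) (scales≤ i j′∈ ≤J) (proj₂ (both j∈ j′∈ r∈ r′∈ z∈r z∈r′))

  length-block : ∀ p → 2 ^ p ≤ℕ length (block p) * 2 ^ s
  length-block p = begin
    2 ^ p                     ≤⟨ ℕ.^-monoʳ-≤ 2 (ℕ.≤-trans (ℕ.m≤n+m∸n p s) (ℕ.≤-reflexive (ℕ.+-comm s (p ∸ s)))) ⟩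
    2 ^ (p ∸ s + s)           ≡⟨ ℕ.^-distribˡ-+-* 2 (p ∸ s) s ⟩
    2 ^ (p ∸ s) * 2 ^ s       ≡⟨ cong (_* 2 ^ s) (length-upTo (2 ^ (p ∸ s))) ⟨
    length (block p) * 2 ^ s  ∎
    where open ℕ.≤-Reasoning

  -- There are L ^ i choices of totals. For each, a factor of scale p has at least 2 ^ p / 2 ^ s
  -- values, and the powers 2 ^ p multiply to 2 ^ J.
  length-products : ∀ i {J} → 8 ^ i * L ≤ℕ J → 2 ^ J * L ^ i ≤ℕ length (products i J) * (2 ^ s) ^ suc i
  length-products zero    {J} _  = begin
    2 ^ J * 1                                     ≡⟨ ℕ.*-identityʳ (2 ^ J) ⟩
    2 ^ J                                         ≤⟨ length-block J ⟩
    length (block J) * 2 ^ s                      ≡⟨ cong₂ _*_ (length-map (element J) (block J)) (ℕ.*-identityʳ (2 ^ s)) ⟨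
    length (products 0 J) * (2 ^ s * 1)           ∎
    where open ℕ.≤-Reasoning
  length-products (suc i) {J} ≤J = begin
    2 ^ J * (L * L ^ i)                                     ≡⟨ swap (2 ^ J) L (L ^ i) ⟩
    L * (2 ^ J * L ^ i)                                     ≡⟨ cong (_* (2 ^ J * L ^ i)) (trans (length-map (8 ^ i * L +_) (upTo L)) (length-upTo L)) ⟨
    length (scales i) * (2 ^ J * L ^ i)                     ≤⟨ length-concatMap-≥ _ each ⟩
    length (products (suc i) J) * (2 ^ s) ^ suc (suc i)     ∎
    where
    open ℕ.≤-Reasoning
    swap : ∀ a b c → a * (b * c) ≡ b * (a * c)
    swap = solve-∀
    each : ∀ {j} → j ∈ᴸ scales i →
           2 ^ J * L ^ i ≤ℕ length (concatMap (multiples (J ∸ j)) (products i j)) * (2 ^ s) ^ suc (suc i)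
    each {j} j∈ = begin
      2 ^ J * L ^ i                              ≡⟨ cong (λ z → 2 ^ z * L ^ i) (ℕ.m∸n+n≡m (scales≤ i j∈ ≤J)) ⟨
      2 ^ (p + j) * L ^ i                        ≡⟨ cong (_* L ^ i) (ℕ.^-distribˡ-+-* 2 p j) ⟩
      2 ^ p * 2 ^ j * L ^ i                      ≡⟨ ℕ.*-assoc (2 ^ p) (2 ^ j) (L ^ i) ⟩
      2 ^ p * (2 ^ j * L ^ i)                    ≤⟨ ℕ.*-monoʳ-≤ (2 ^ p) (length-products i (scales≥ i j∈)) ⟩
      2 ^ p * (m * (2 ^ s) ^ suc i)              ≡⟨ swap (2 ^ p) m ((2 ^ s) ^ suc i) ⟩
      m * (2 ^ p * (2 ^ s) ^ suc i)              ≤⟨ length-concatMap-≥ (multiples p) multiple ⟩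
      length (concatMap (multiples p) (products i j)) * (2 ^ s) ^ suc (suc i)  ∎
      where
      p = J ∸ j
      m = length (products i j)
      multiple : ∀ {r} → r ∈ᴸ products i j →
                 2 ^ p * (2 ^ s) ^ suc i ≤ℕ length (multiples p r) * (2 ^ s) ^ suc (suc i)
      multiple {r} _ = begin
        2 ^ p * (2 ^ s) ^ suc i                              ≤⟨ ℕ.*-monoˡ-≤ ((2 ^ s) ^ suc i) (length-block p) ⟩
        length (block p) * 2 ^ s * (2 ^ s) ^ suc i           ≡⟨ ℕ.*-assoc (length (block p)) (2 ^ s) _ ⟩
        length (block p) * (2 ^ s) ^ suc (suc i)             ≡⟨ cong (_* (2 ^ s) ^ suc (suc i)) (length-map (λ x → element p x * r) (block p)) ⟨
        length (multiples p r) * (2 ^ s) ^ suc (suc i)       ∎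

-- A power of two in place of J ^ α.

2^-cancel-< : ∀ {m n} → 2 ^ m <ℕ 2 ^ n → m <ℕ n
2^-cancel-< {m} {n} 2^m<2^n with n ℕ.≤? m
... | yes n≤m = contradiction (ℕ.^-monoʳ-≤ 2 n≤m) (ℕ.<⇒≱ 2^m<2^n)
... | no  n≰m = ℕ.≰⇒> n≰m

*-distribʳ-^ : ∀ m n k → (m * n) ^ k ≡ m ^ k * n ^ k
*-distribʳ-^ m n zero    = refl
*-distribʳ-^ m n (suc k) = trans (cong (m * n *_) (*-distribʳ-^ m n k)) (interchange m n (m ^ k) (n ^ k))
  where
  interchange : ∀ a b c d → a * b * (c * d) ≡ a * c * (b * d)
  interchange = solve-∀

-- 2 ^ saving κ J is, up to a constant factor, J ^ (κ / (κ + 3)) ≈ (log X) ^ α(k) for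
-- k = κ + 2 and X = 4 ^ J.
module _ (κ : ℕ) where

  private
    K : ℕ
    K = 3 + κ

    -- With 2 + J in place of J the base is positive, and 4 + J ≤ 2 (2 + J) holds from J = 0 on, as
    -- `saving-step` requires.
    savingBracket : ∀ J → ∃[ t ] (0 ≤ℕ t × 2 ^ (t * K) ≤ℕ (2 + J) ^ κ × (2 + J) ^ κ <ℕ 2 ^ (suc t * K))
    savingBracket J = bracket (λ t → 2 ^ (t * K)) 0 V (ℕ.m^n>0 (2 + J) κ) (begin-strict
      V                  <⟨ n<2^n V ⟩
      2 ^ V              ≤⟨ ℕ.^-monoʳ-≤ 2 (ℕ.≤-trans (ℕ.m≤m+n V 0) (ℕ.m≤m*n (V + 0) K)) ⟩
      2 ^ ((V + 0) * K)  ∎)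
      where
      open ℕ.≤-Reasoning
      V = (2 + J) ^ κ

  saving : ℕ → ℕ
  saving J = proj₁ (savingBracket J)

  saving-lower : ∀ J → 2 ^ (saving J * K) ≤ℕ (2 + J) ^ κ
  saving-lower J = proj₁ (proj₂ (proj₂ (savingBracket J)))

  saving-upper : ∀ J → (2 + J) ^ κ <ℕ 2 ^ (suc (saving J) * K)
  saving-upper J = proj₂ (proj₂ (proj₂ (savingBracket J)))

  saving-mono : ∀ {I J} → I ≤ℕ J → saving I ≤ℕ saving J
  saving-mono {I} {J} I≤J = ℕ.s≤s⁻¹ (ℕ.*-cancelʳ-< K _ _ (2^-cancel-< (begin-strict
    2 ^ (saving I * K)        ≤⟨ saving-lower I ⟩
    (2 + I) ^ κ               ≤⟨ ℕ.^-monoˡ-≤ κ (ℕ.+-monoʳ-≤ 2 I≤J) ⟩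
    (2 + J) ^ κ               <⟨ saving-upper J ⟩
    2 ^ (suc (saving J) * K)  ∎)))
    where open ℕ.≤-Reasoning

  -- Doubling the base costs 2 ^ κ ≤ 2 ^ K, that is, one unit of saving. This serves both the growth
  -- of `saving` and the bound 3 + 2J for log X.
  saving-double : ∀ {I J} → I ≤ℕ 2 * (2 + J) → I ^ κ <ℕ 2 ^ ((2 + saving J) * K)
  saving-double {I} {J} I≤ = begin-strict
    I ^ κ                           ≤⟨ ℕ.^-monoˡ-≤ κ I≤ ⟩
    (2 * (2 + J)) ^ κ               ≡⟨ *-distribʳ-^ 2 (2 + J) κ ⟩
    2 ^ κ * (2 + J) ^ κ             <⟨ ℕ.*-monoʳ-< (2 ^ κ) {{ℕ.m^n≢0 2 κ}} (saving-upper J) ⟩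
    2 ^ κ * 2 ^ (suc (saving J) * K)  ≤⟨ ℕ.*-monoˡ-≤ _ (ℕ.^-monoʳ-≤ 2 (ℕ.m≤n+m κ 3)) ⟩
    2 ^ K * 2 ^ (suc (saving J) * K)  ≡⟨ ℕ.^-distribˡ-+-* 2 K _ ⟨
    2 ^ ((2 + saving J) * K)        ∎
    where open ℕ.≤-Reasoning

  saving-step : ∀ J → saving (2 + J) ≤ℕ suc (saving J)
  saving-step J = ℕ.s≤s⁻¹ (ℕ.*-cancelʳ-< K _ _ (2^-cancel-<
    (ℕ.≤-<-trans (saving-lower (2 + J)) (saving-double {4 + J} {J} (begin
      4 + J            ≤⟨ ℕ.+-monoʳ-≤ 4 (ℕ.m≤m+n J J) ⟩
      4 + (J + J)      ≡⟨ regroup J ⟩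
      2 * (2 + J)      ∎)))))
    where
    open ℕ.≤-Reasoning
    regroup : ∀ J → 4 + (J + J) ≡ 2 * (2 + J)
    regroup = solve-∀

  -- Makes `J ∸ saving J` a true difference, so that a scale has exactly 2 ^ J / 2 ^ s elements. The
  -- reason is κ < K.
  saving≤ : ∀ J → saving J ≤ℕ J
  saving≤ J = ℕ.s≤s⁻¹ (ℕ.*-cancelʳ-< K _ _ (2^-cancel-< (begin-strict
    2 ^ (saving J * K)     ≤⟨ saving-lower J ⟩
    (2 + J) ^ κ            ≤⟨ ℕ.^-monoˡ-≤ κ (n<2^n (suc J)) ⟩
    (2 ^ suc J) ^ κ        ≡⟨ ℕ.^-*-assoc 2 (suc J) κ ⟩
    2 ^ (suc J * κ)        <⟨ ℕ.^-monoʳ-< 2 (s≤s (s≤s z≤n)) (ℕ.*-monoʳ-< (suc J) {κ} {K} (ℕ.m≤n+m (suc κ) 2)) ⟩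
    2 ^ (suc J * K)        ∎)))
    where open ℕ.≤-Reasoning

-- The shifts of one scale.

size-arithmetic : ∀ {H T m q Q a b e w V d l} → H ≤ℕ a * b → T * m ≤ℕ e * (w * w) → q * Q ≤ℕ V →
                  b * V ≤ℕ d * l → w * l ≤ℕ m * Q → 0 <ℕ w * l → H * T * q ≤ℕ a * e * d * w
size-arithmetic {H} {T} {m} {q} {Q} {a} {b} {e} {w} {V} {d} {l} H≤ Tm≤ qQ≤ bV≤ wl≤ 0<wl =
  ℕ.*-cancelʳ-≤ _ _ (m * Q) {{ℕ.>-nonZero (ℕ.<-≤-trans 0<wl wl≤)}} (begin
    H * T * q * (m * Q)          ≡⟨ expand H T q m Q ⟩
    H * (T * m) * (q * Q)        ≤⟨ ℕ.*-mono-≤ (ℕ.*-mono-≤ H≤ Tm≤) qQ≤ ⟩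
    a * b * (e * (w * w)) * V    ≡⟨ collect a b e w V ⟩
    a * e * w * (w * (b * V))    ≤⟨ ℕ.*-monoʳ-≤ (a * e * w) (ℕ.*-monoʳ-≤ w bV≤) ⟩
    a * e * w * (w * (d * l))    ≡⟨ regroup (a * e) w d l ⟩
    a * e * d * w * (w * l)      ≤⟨ ℕ.*-monoʳ-≤ (a * e * d * w) wl≤ ⟩
    a * e * d * w * (m * Q)      ∎)
  where
  open ℕ.≤-Reasoning
  expand : ∀ H T q m Q → H * T * q * (m * Q) ≡ H * (T * m) * (q * Q)
  expand = solve-∀
  collect : ∀ a b c d e → a * b * (c * (d * d)) * e ≡ a * c * d * (d * (b * e))
  collect = solve-∀
  regroup : ∀ a b c d → a * b * (b * (c * d)) ≡ a * c * b * (b * d)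
  regroup = solve-∀

-- The factors come from h + 1 ≤ (7 + κ)(2 + J), from 2 ^ h = 2 ^ (6 + κ) 4 ^ J, and from the (κ +
-- 1)-st power of `2+J≤`.
complementConstant : ℕ → ℕ
complementConstant κ = (7 + κ) * 2 ^ (6 + κ) * (3 * 8 ^ suc κ) ^ suc κ

-- One binary digit above the bound 2 ^ (2 + κ + 2J) for products of κ + 2 factors.
topScale : ℕ → ℕ → ℕ
topScale κ J = 2 ^ (J + J + (3 + κ))

module ScaleComplement (κ J : ℕ) (large : 8 ^ suc κ ≤ℕ J) where

  private instance _ = ℕ.m^n≢0 8 (suc κ)

  L s N h : ℕ
  L = J / 8 ^ suc κ
  s = saving κ J
  N = topScale κ J
  h = 3 + (J + J + (3 + κ))

  open Products s L

  S : List ℕ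
  S = products (suc κ) J

  0<L : 0 <ℕ L
  0<L = m≥n⇒m/n>0 large

  8L≤J : 8 ^ suc κ * L ≤ℕ J
  8L≤J = ℕ.≤-trans (ℕ.≤-reflexive (ℕ.*-comm (8 ^ suc κ) L)) (m/n*n≤m J (8 ^ suc κ))

  -- Shows that L is of order J, so the L ^ (k - 1) choices of totals are of order J ^ (k - 1).
  2+J≤ : 2 + J ≤ℕ 3 * 8 ^ suc κ * L
  2+J≤ = begin
    2 + J                        ≡⟨ cong (2 +_) (m≡m%n+[m/n]*n J D) ⟩
    2 + (J % D + L * D)          ≡⟨⟩
    1 + (suc (J % D) + L * D)    ≤⟨ ℕ.+-mono-≤ 1≤DL (ℕ.+-monoˡ-≤ (L * D) (ℕ.≤-trans (m%n<n J D) (ℕ.m≤m*n D L {{ℕ.>-nonZero 0<L}}))) ⟩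
    D * L + (D * L + L * D)      ≡⟨ regroup D L ⟩
    3 * D * L                    ∎
    where
    open ℕ.≤-Reasoning
    D = 8 ^ suc κ
    1≤DL : 1 ≤ℕ D * L
    1≤DL = ℕ.*-mono-≤ {1} {D} {1} {L} (ℕ.m^n>0 8 (suc κ)) 0<L
    regroup : ∀ D L → D * L + (D * L + L * D) ≡ 3 * D * L
    regroup = solve-∀

  S! : Unique S
  S! = products-Unique 0<L (suc κ) 8L≤J

  S< : ∀ {n} → n ∈ᴸ S → n <ℕ N
  S< n∈ = ℕ.≤-<-trans (proj₂ (products-bounds (suc κ) 8L≤J n∈)) (ℕ.^-monoʳ-< 2 (s≤s (s≤s z≤n))
    (ℕ.≤-reflexive (ℕ.+-comm (3 + κ) (J + J))))

  m : ℕ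
  m = length S

  m≤N : m ≤ℕ N
  m≤N = ℕ.≤-trans (length-mono-⊆ S! (λ n∈ → ∈-upTo⁺ (S< n∈))) (ℕ.≤-reflexive (length-upTo N))

  Z : ℕ
  Z = m * (2 ^ s) ^ (2 + κ)

  Z≥ : 2 ^ J * L ^ suc κ ≤ℕ Z
  Z≥ = length-products (suc κ) 8L≤J

  0<2^JL : 0 <ℕ 2 ^ J * L ^ suc κ
  0<2^JL = ℕ.*-mono-≤ {1} {2 ^ J} {1} {L ^ suc κ} (ℕ.m^n>0 2 J) (ℕ.m^n>0 L {{ℕ.>-nonZero 0<L}} (suc κ))

  private instance
    m≢0 : NonZero m
    m≢0 = ℕ.m*n≢0⇒m≢0 m {{ℕ.>-nonZero (ℕ.<-≤-trans 0<2^JL Z≥)}}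

  -- 7N / m rounded up. As m ≤ N, the rounding keeps T m ≤ 8N = 2 ^ h.
  T : ℕ
  T = suc (7 * N / m)

  2^h : 2 ^ h ≡ 8 * N
  2^h = eq N
    where
    eq : ∀ N → 2 * (2 * (2 * N)) ≡ 8 * N
    eq = solve-∀

  T≥ : 7 * N ≤ℕ T * m
  T≥ = begin
    7 * N                              ≡⟨ m≡m%n+[m/n]*n (7 * N) m ⟩
    7 * N % m + 7 * N / m * m          ≤⟨ ℕ.+-monoˡ-≤ _ (ℕ.<⇒≤ (m%n<n (7 * N) m)) ⟩
    T * m                              ∎
    where open ℕ.≤-Reasoning

  T≤ : T * m ≤ℕ 2 ^ h
  T≤ = begin
    m + 7 * N / m * m   ≤⟨ ℕ.+-mono-≤ m≤N (m/n*n≤m (7 * N) m) ⟩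
    8 * N               ≡⟨ 2^h ⟨
    2 ^ h               ∎
    where open ℕ.≤-Reasoning

  6N≤ : 6 * N ≤ℕ T * 2 ^ h
  6N≤ = begin
    6 * N      ≤⟨ ℕ.*-monoˡ-≤ N {6} {8} (ℕ.m≤n+m 6 2) ⟩
    8 * N      ≡⟨ 2^h ⟨
    2 ^ h      ≤⟨ ℕ.m≤m+n (2 ^ h) _ ⟩
    T * 2 ^ h  ∎
    where open ℕ.≤-Reasoning

  complement : Σ[ B ∈ List ℕ ] (All (N ≤ℕ_) B × length B ≤ℕ suc h * T ×
                 (∀ {n} → N + N ≤ℕ n → n <ℕ 8 * N → Covers S B n))
  complement = additiveComplement N T h S (ℕ.m^n>0 2 (J + J + (3 + κ))) S! S< T≥ 6N≤

  -- The exponent is decided here. Of the k + 1 factors 2 ^ s bounded by (2 + J) ^ (k - 2), k pay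
  -- for the thinned blocks and one is the saving claimed for the shifts. The factor 2 + J from the
  -- h halvings completes the power to k - 1, which L ^ (k - 1) matches.
  size : suc h * T * 2 ^ s ≤ℕ complementConstant κ * 2 ^ J
  size = size-arithmetic {H = suc h} {T} {m} {2 ^ s} {(2 ^ s) ^ (2 + κ)} {7 + κ} {2 + J} {2 ^ (6 + κ)} {2 ^ J}
    {(2 + J) ^ κ} {(3 * 8 ^ suc κ) ^ suc κ} {L ^ suc κ}
    suc-h≤ (ℕ.≤-trans T≤ (ℕ.≤-reflexive 2^h-split)) power≤ top≤ Z≥ 0<2^JL
    where
    power≤ : (2 ^ s) ^ (3 + κ) ≤ℕ (2 + J) ^ κ
    power≤ = ℕ.≤-trans (ℕ.≤-reflexive (ℕ.^-*-assoc 2 s (3 + κ))) (saving-lower κ J)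
    top≤ : (2 + J) ^ suc κ ≤ℕ (3 * 8 ^ suc κ) ^ suc κ * L ^ suc κ
    top≤ = ℕ.≤-trans (ℕ.^-monoˡ-≤ (suc κ) 2+J≤) (ℕ.≤-reflexive (*-distribʳ-^ (3 * 8 ^ suc κ) L (suc κ)))
    suc-h≤ : suc h ≤ℕ (7 + κ) * (2 + J)
    suc-h≤ = ℕ.≤-trans (ℕ.m≤m+n _ (7 + κ + (5 * J + κ * J))) (ℕ.≤-reflexive (eq κ J))
      where
      eq : ∀ κ J → 4 + (J + J + (3 + κ)) + (7 + κ + (5 * J + κ * J)) ≡ (7 + κ) * (2 + J)
      eq = solve-∀
    2^h-split : 2 ^ h ≡ 2 ^ (6 + κ) * (2 ^ J * 2 ^ J)
    2^h-split = trans (cong (2 ^_) (exponent κ J)) (trans (ℕ.^-distribˡ-+-* 2 (6 + κ) (J + J)) (cong (2 ^ (6 + κ) *_) (ℕ.^-distribˡ-+-* 2 J J)))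
      where
      exponent : ∀ κ J → 3 + (J + J + (3 + κ)) ≡ 6 + κ + (J + J)
      exponent = solve-∀

-- The intervals in `covers` abut. Scales below 8 ^ (κ + 1) receive no shifts, as their intervals
-- end at or below `threshold` and lie in `A` entirely.
record Complement (κ J : ℕ) : Set where
  field
    shifts  : List ℕ
    shifts≥ : All (2 ^ (J + J) ≤ℕ_) shifts
    size    : length shifts * 2 ^ saving κ J ≤ℕ complementConstant κ * 2 ^ J
    covers  : 8 ^ suc κ ≤ℕ J → ∀ {n} → 2 * topScale κ J ≤ℕ n → n <ℕ 2 * topScale κ (suc J) →
              ∃[ L ] (8 ^ suc κ * L ≤ℕ J × Covers (Products.products (saving κ J) L (suc κ) J) shifts n)

topScale-suc : ∀ κ J → 2 * topScale κ (suc J) ≡ 8 * topScale κ J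
topScale-suc κ J = trans (cong (λ z → 2 * 2 ^ z) (shift J (3 + κ))) (eq (topScale κ J))
  where
  shift : ∀ J c → suc J + suc J + c ≡ 2 + (J + J + c)
  shift = solve-∀
  eq : ∀ N → 2 * (2 * (2 * N)) ≡ 8 * N
  eq = solve-∀

scaleComplement : ∀ κ J → Dec (8 ^ suc κ ≤ℕ J) → Complement κ J
scaleComplement κ J (no small)  = record
  { shifts = [] ; shifts≥ = [] ; size = z≤n ; covers = λ large → contradiction large small }
scaleComplement κ J (yes large) = record
  { shifts  = proj₁ complement
  ; shifts≥ = All.map (ℕ.≤-trans (ℕ.^-monoʳ-≤ 2 (ℕ.m≤m+n (J + J) (3 + κ)))) (proj₁ (proj₂ complement))
  ; size    = ℕ.≤-trans (ℕ.*-monoˡ-≤ (2 ^ saving κ J) (proj₁ (proj₂ (proj₂ complement)))) size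
  ; covers  = λ _ {n} ≤n n< → L , 8L≤J , proj₂ (proj₂ (proj₂ complement))
      (subst (_≤ℕ n) (double N) ≤n) (subst (n <ℕ_) (topScale-suc κ J) n<)
  }
  where
  open ScaleComplement κ J large
  double : ∀ N → 2 * N ≡ N + N
  double = solve-∀

-- The set `A` and its counting function.

below : (ℕ → List ℕ) → ℕ → List ℕ
below ℓ zero    = ℓ 0
below ℓ (suc J) = ℓ (suc J) ++ below ℓ J

∈-below⁺ : ∀ ℓ {I J n} → I ≤ℕ J → n ∈ᴸ ℓ I → n ∈ᴸ below ℓ J
∈-below⁺ ℓ {J = zero}  z≤n n∈ = n∈
∈-below⁺ ℓ {I} {suc J} I≤  n∈ with ℕ.m≤n⇒m<n∨m≡n I≤
... | inj₁ I<   = ∈-++⁺ʳ (ℓ (suc J)) (∈-below⁺ ℓ (ℕ.s≤s⁻¹ I<) n∈)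
... | inj₂ refl = ∈-++⁺ˡ n∈

∈-below⁻ : ∀ ℓ J {n} → n ∈ᴸ below ℓ J → ∃[ I ] n ∈ᴸ ℓ I
∈-below⁻ ℓ zero    n∈ = 0 , n∈
∈-below⁻ ℓ (suc J) n∈ with ∈-++⁻ (ℓ (suc J)) n∈
... | inj₁ n∈ℓ = suc J , n∈ℓ
... | inj₂ n∈b = ∈-below⁻ ℓ J n∈b

-- The bounds 2 ^ (J ∸ s J) at least double over every two steps.
length-below : ∀ ℓ (s : ℕ → ℕ) c → (∀ J → s J ≤ℕ s (suc J)) → (∀ J → s (2 + J) ≤ℕ suc (s J)) →
               (∀ J → length (ℓ J) * 2 ^ s J ≤ℕ c * 2 ^ J) →
               ∀ J → length (below ℓ J) * 2 ^ s J ≤ℕ 4 * c * 2 ^ J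
length-below ℓ s c s-mono s-step ℓ≤ = go
  where
  open ℕ.≤-Reasoning
  raise : ∀ l {t u} → t ≤ℕ suc u → l * 2 ^ t ≤ℕ 2 * (l * 2 ^ u)
  raise l {t} {u} t≤ = begin
    l * 2 ^ t        ≤⟨ ℕ.*-monoʳ-≤ l (ℕ.^-monoʳ-≤ 2 t≤) ⟩
    l * (2 * 2 ^ u)  ≡⟨ swap l (2 ^ u) ⟩
    2 * (l * 2 ^ u)  ∎
    where
    swap : ∀ l x → l * (2 * x) ≡ 2 * (l * x)
    swap = solve-∀
  s-step₁ : ∀ J → s (suc J) ≤ℕ suc (s J)
  s-step₁ J = ℕ.≤-trans (s-mono (suc J)) (s-step J)
  split : ∀ J x → length (below ℓ (suc J)) * x ≡ length (ℓ (suc J)) * x + length (below ℓ J) * x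
  split J x = trans (cong (_* x) (length-++ (ℓ (suc J)))) (ℕ.*-distribʳ-+ x (length (ℓ (suc J))) _)
  go : ∀ J → length (below ℓ J) * 2 ^ s J ≤ℕ 4 * c * 2 ^ J
  go zero = ℕ.≤-trans (ℓ≤ 0) (ℕ.*-monoˡ-≤ 1 (ℕ.m≤m+n c (3 * c)))
  go (suc zero) = begin
    length (below ℓ 1) * 2 ^ s 1                               ≡⟨ split 0 (2 ^ s 1) ⟩
    length (ℓ 1) * 2 ^ s 1 + length (ℓ 0) * 2 ^ s 1            ≤⟨ ℕ.+-mono-≤ (ℓ≤ 1) (raise (length (ℓ 0)) (s-step₁ 0)) ⟩
    c * 2 + 2 * (length (ℓ 0) * 2 ^ s 0)                       ≤⟨ ℕ.+-monoʳ-≤ (c * 2) (ℕ.*-monoʳ-≤ 2 (ℓ≤ 0)) ⟩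
    c * 2 + 2 * (c * 1)                                        ≤⟨ ℕ.m≤m+n _ (4 * c) ⟩
    c * 2 + 2 * (c * 1) + 4 * c                                ≡⟨ eq c ⟩
    4 * c * 2                                                  ∎
    where
    eq : ∀ c → c * 2 + 2 * (c * 1) + 4 * c ≡ 4 * c * 2
    eq = solve-∀
  go (suc (suc J)) = begin
    length (below ℓ (2 + J)) * x                               ≡⟨ split (suc J) x ⟩
    length (ℓ (2 + J)) * x + length (below ℓ (suc J)) * x      ≡⟨ cong (length (ℓ (2 + J)) * x +_) (split J x) ⟩
    length (ℓ (2 + J)) * x + (length (ℓ (suc J)) * x + length (below ℓ J) * x)
      ≤⟨ ℕ.+-mono-≤ (ℓ≤ (2 + J)) (ℕ.+-mono-≤
           (ℕ.≤-trans (raise (length (ℓ (suc J))) (s-step₁ (suc J))) (ℕ.*-monoʳ-≤ 2 (ℓ≤ (suc J))))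
           (ℕ.≤-trans (raise (length (below ℓ J)) (s-step J)) (ℕ.*-monoʳ-≤ 2 (go J)))) ⟩
    -- The constant 4 reproduces itself: in units of c 2 ^ J the terms are 4 + 4 + 8 = 4 · 4.
    c * 2 ^ (2 + J) + (2 * (c * 2 ^ suc J) + 2 * (4 * c * 2 ^ J))  ≡⟨ eq c (2 ^ J) ⟩
    4 * c * 2 ^ (2 + J)                                        ∎
    where
    x = 2 ^ s (2 + J)
    eq : ∀ c y → c * (2 * (2 * y)) + (2 * (c * (2 * y)) + 2 * (4 * c * y)) ≡ 4 * c * (2 * (2 * y))
    eq = solve-∀

module Construction (κ : ℕ) where

  open Complement

  complementAt : ∀ J → Complement κ J
  complementAt J = scaleComplement κ J (8 ^ suc κ ℕ.≤? J)

  complements : ℕ → List ℕ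
  complements J = shifts (complementAt J)

  elements : ℕ → List ℕ
  elements J = map (element J) (upTo (2 ^ (J ∸ saving κ J)))

  level : ℕ → List ℕ
  level J = elements J ++ complements J

  threshold : ℕ
  threshold = 2 * topScale κ (8 ^ suc κ)

  levelConstant : ℕ
  levelConstant = 1 + complementConstant κ

  level≥ : ∀ J {n} → n ∈ᴸ level J → 2 ^ (J + J) ≤ℕ n
  level≥ J n∈ with ∈-++⁻ (elements J) n∈
  ... | inj₂ n∈B = All.lookup (shifts≥ (complementAt J)) n∈B
  ... | inj₁ n∈E with ∈-map⁻ (element J) n∈E
  ...   | x , _ , refl = ℕ.<⇒≤ (element> J x)

  length-level : ∀ J → length (level J) * 2 ^ saving κ J ≤ℕ levelConstant * 2 ^ J
  length-level J = begin
    length (level J) * 2 ^ s                                ≡⟨ cong (_* 2 ^ s) (length-++ (elements J)) ⟩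
    (length (elements J) + length (complements J)) * 2 ^ s  ≡⟨ ℕ.*-distribʳ-+ (2 ^ s) (length (elements J)) _ ⟩
    length (elements J) * 2 ^ s + length (complements J) * 2 ^ s
      ≤⟨ ℕ.+-mono-≤ (ℕ.≤-reflexive |elements|) (size (complementAt J)) ⟩
    levelConstant * 2 ^ J                                   ∎
    where
    open ℕ.≤-Reasoning
    s = saving κ J
    |elements| : length (elements J) * 2 ^ s ≡ 2 ^ J
    |elements| = trans (cong (_* 2 ^ s) (trans (length-map (element J) (upTo (2 ^ (J ∸ s)))) (length-upTo (2 ^ (J ∸ s)))))
      (trans (sym (ℕ.^-distribˡ-+-* 2 (J ∸ s) s)) (cong (2 ^_) (ℕ.m∸n+n≡m (saving≤ κ J))))

  -- Searching only the levels up to `n` makes membership decidable and loses nothing, because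
  -- members of level J are at least 4 ^ J > J.
  A : Pred ℕ 0ℓ
  A n = n <ℕ threshold ⊎ n ∈ᴸ below level n

  A? : Decidable A
  A? n = (n ℕ.<? threshold) ⊎-dec (n ∈? below level n)

  level⊆A : ∀ J {n} → n ∈ᴸ level J → A n
  level⊆A J {n} n∈ = inj₂ (∈-below⁺ level (begin
    J            ≤⟨ ℕ.m≤m+n J J ⟩
    J + J        <⟨ n<2^n (J + J) ⟩
    2 ^ (J + J)  ≤⟨ level≥ J n∈ ⟩
    n            ∎) n∈)
    where open ℕ.≤-Reasoning

  elements⊆A : ∀ {s p x} → saving κ p ≤ℕ s → x ∈ᴸ upTo (2 ^ (p ∸ s)) → A (element p x)
  elements⊆A {s} {p} s≤ x∈ = level⊆A p (∈-++⁺ˡ (∈-map⁺ (element p)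
    (∈-upTo⁺ (ℕ.<-≤-trans (∈-upTo⁻ x∈) (ℕ.^-monoʳ-≤ 2 (ℕ.∸-monoʳ-≤ p s≤))))))

  -- All factors are thinned by the saving of the top scale `J₀`. At smaller scales `A` is thinned
  -- less, as `saving` is monotone, so it contains them.
  products⊆A^ : ∀ {J₀} L i {J n} → J ≤ℕ J₀ → 8 ^ i * L ≤ℕ J →
                n ∈ᴸ Products.products (saving κ J₀) L i J → (A ^ˢ suc i) n
  products⊆A^ {J₀} L zero    {J} J≤ _  n∈ with ∈-map⁻ (element J) n∈
  ... | x , x∈ , refl = elements⊆A (saving-mono κ J≤) x∈
  products⊆A^ {J₀} L (suc i) {J} J≤ ≤J n∈ with Products.∈-products⁻ (saving κ J₀) L i J n∈
  ... | j , r , x , j∈ , r∈ , x∈ , refl = element (J ∸ j) x , r ,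
    elements⊆A (saving-mono κ (ℕ.≤-trans (ℕ.m∸n≤m J j) J≤)) x∈ ,
    products⊆A^ L i (ℕ.≤-trans (Products.scales≤ (saving κ J₀) L i j∈ ≤J) J≤)
      (Products.scales≥ (saving κ J₀) L i j∈) r∈ , refl

  -- For the integers below `threshold`, represented as 0 + n.
  0∈A^ : ∀ i → (A ^ˢ suc i) 0
  0∈A^ zero    = inj₁ (ℕ.*-monoʳ-< 2 (ℕ.m^n>0 2 (8 ^ suc κ + 8 ^ suc κ + (3 + κ))))
  0∈A^ (suc i) = 0 , 0 , 0∈A^ zero , 0∈A^ i , refl

  A^+A-at : ∀ {n} J → 8 ^ suc κ ≤ℕ J → 2 * topScale κ J ≤ℕ n → n <ℕ 2 * topScale κ (suc J) →
            ((A ^ˢ (2 + κ)) +ˢ A) n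
  A^+A-at J large ≤n n< = fromCovers (covers (complementAt J) large ≤n n<)
    where
    fromCovers : ∀ {n} → ∃[ L ] (8 ^ suc κ * L ≤ℕ J × Covers (Products.products (saving κ J) L (suc κ) J) (complements J) n) →
                 ((A ^ˢ (2 + κ)) +ˢ A) n
    fromCovers (L , 8L≤J , n∈S+B) with find n∈S+B
    ... | b , b∈ , n∈ with ∈-map⁻ (_+ b) n∈
    ...   | σ , σ∈ , eq = σ , b , products⊆A^ L (suc κ) ℕ.≤-refl 8L≤J σ∈ ,
            level⊆A J (∈-++⁺ʳ (elements J) b∈) , eq

  A^+A : ∀ n → ((A ^ˢ (2 + κ)) +ˢ A) n
  A^+A n = byCases (n ℕ.<? threshold)
    where
    open ℕ.≤-Reasoning
    I : ℕ
    I = n + 8 ^ suc κ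
    n< : n <ℕ 2 * topScale κ I
    n< = begin-strict
      n                 <⟨ n<2^n n ⟩
      2 ^ n             ≤⟨ ℕ.^-monoʳ-≤ 2 (ℕ.≤-trans (ℕ.m≤m+n n (8 ^ suc κ)) (ℕ.≤-trans (ℕ.m≤m+n I I) (ℕ.m≤m+n (I + I) (3 + κ)))) ⟩
      topScale κ I      ≤⟨ ℕ.m≤n*m (topScale κ I) 2 ⟩
      2 * topScale κ I  ∎
    byCases : Dec (n <ℕ threshold) → ((A ^ˢ (2 + κ)) +ˢ A) n
    byCases (yes n<t) = 0 , n , 0∈A^ (suc κ) , inj₁ n<t , refl
    byCases (no  n≮t) with bracket (λ J → 2 * topScale κ J) (8 ^ suc κ) n (ℕ.≮⇒≥ n≮t) n<
    ... | J , large , ≤n , n<′ = A^+A-at J large ≤n n<′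

  countConstant : ℕ
  countConstant = threshold + 8 * levelConstant

  -- Levels beyond J + 1 start above n. In `countConstant` the 8 is the 4 of `length-below` times 2
  -- for the step from J to J + 1.
  count-bound : ∀ J {n} → n ≤ℕ 2 ^ (suc J + suc J) →
                length (filter A? (applyUpTo suc n)) * 2 ^ saving κ J ≤ℕ countConstant * 2 ^ J
  count-bound J {n} n≤ = begin
    length (filter A? (applyUpTo suc n)) * 2 ^ s                ≤⟨ ℕ.*-monoˡ-≤ (2 ^ s) (length-mono-⊆ filter! filter⊆) ⟩
    length (upTo threshold ++ below level (suc J)) * 2 ^ s      ≡⟨ cong (_* 2 ^ s) (trans (length-++ (upTo threshold)) (cong (_+ b) (length-upTo threshold))) ⟩
    (threshold + b) * 2 ^ s                                     ≡⟨ ℕ.*-distribʳ-+ (2 ^ s) threshold b ⟩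
    threshold * 2 ^ s + b * 2 ^ s                               ≤⟨ ℕ.+-mono-≤ (ℕ.*-monoʳ-≤ threshold (ℕ.^-monoʳ-≤ 2 (saving≤ κ J)))
                                                                     (ℕ.*-monoʳ-≤ b (ℕ.^-monoʳ-≤ 2 (saving-mono κ (ℕ.n≤1+n J)))) ⟩
    threshold * 2 ^ J + b * 2 ^ saving κ (suc J)                ≤⟨ ℕ.+-monoʳ-≤ (threshold * 2 ^ J)
                                                                     (length-below level (saving κ) levelConstant (λ I → saving-mono κ (ℕ.n≤1+n I)) (saving-step κ) length-level (suc J)) ⟩
    threshold * 2 ^ J + 4 * levelConstant * 2 ^ suc J           ≡⟨ collect threshold levelConstant (2 ^ J) ⟩
    countConstant * 2 ^ J                                       ∎
    where
    open ℕ.≤-Reasoning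
    s = saving κ J
    b = length (below level (suc J))
    collect : ∀ t c y → t * y + 4 * c * (2 * y) ≡ (t + 8 * c) * y
    collect = solve-∀
    filter! : Unique (filter A? (applyUpTo suc n))
    filter! = Unique.filter⁺ A? (Unique.applyUpTo⁺₁ suc n (λ i<j _ eq → ℕ.<⇒≢ i<j (ℕ.suc-injective eq)))
    filter⊆ : filter A? (applyUpTo suc n) ⊆ᴸ upTo threshold ++ below level (suc J)
    filter⊆ {a} a∈ with ∈-filter⁻ A? {xs = applyUpTo suc n} a∈
    ... | _  , inj₁ a<  = ∈-++⁺ˡ (∈-upTo⁺ a<)
    ... | a∈ , inj₂ a∈b with ∈-below⁻ level a a∈b | ∈-applyUpTo⁻ suc {n = n} a∈
    ...   | I , a∈I | i , i<n , refl = ∈-++⁺ʳ (upTo threshold) (∈-below⁺ level I≤ a∈I)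
      where
      I≤ : I ≤ℕ suc J
      I≤ with I ℕ.≤? suc J
      ... | yes I≤J = I≤J
      ... | no  I≰J = contradiction (ℕ.≤-trans (level≥ I a∈I) (ℕ.≤-trans i<n n≤))
              (ℕ.<⇒≱ (ℕ.^-monoʳ-< 2 (s≤s (s≤s z≤n)) (ℕ.+-mono-< (ℕ.≰⇒> I≰J) (ℕ.≰⇒> I≰J))))

-- Passage to rational and real bounds.

fromℕ : ℕ → ℚ
fromℕ n = ℤ.+ n /ℚ 1

fromℕ-normal : ∀ n → fromℕ n ≡ mkℚ (ℤ.+ n) 0 (Coprimality.sym (1-coprimeTo n))
fromℕ-normal n = ℚ.normalize-coprime (Coprimality.sym (1-coprimeTo n))

fromℕ-mono-< : ∀ {m n} → m <ℕ n → fromℕ m < fromℕ n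
fromℕ-mono-< {m} {n} m<n = subst₂ _<_ (sym (fromℕ-normal m)) (sym (fromℕ-normal n))
  (*<* (ℤ.*-monoʳ-<-pos (ℤ.+ 1) (ℤ.+<+ m<n)))

fromℕ-mono-≤ : ∀ {m n} → m ≤ℕ n → fromℕ m ≤ fromℕ n
fromℕ-mono-≤ {m} {n} m≤n = subst₂ _≤_ (sym (fromℕ-normal m)) (sym (fromℕ-normal n))
  (*≤* (ℤ.*-monoʳ-≤-nonNeg (ℤ.+ 1) (ℤ.+≤+ m≤n)))

fromℕ-cancel-< : ∀ {m n} → fromℕ m < fromℕ n → m <ℕ n
fromℕ-cancel-< {m} {n} m<n with m ℕ.<? n
... | yes p = p
... | no ¬p = contradiction (ℚ.<-≤-trans m<n (fromℕ-mono-≤ (ℕ.≮⇒≥ ¬p))) (ℚ.<-irrefl refl)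

fromℕ-≥0 : ∀ n → 0ℚ ≤ fromℕ n
fromℕ-≥0 n = fromℕ-mono-≤ {0} {n} z≤n

fromℕ-* : ∀ m n → fromℕ (m * n) ≡ fromℕ m *ℚ fromℕ n
fromℕ-* m n = trans (cong (_/ℚ 1) (ℤ.pos-* m n))
  (sym (cong₂ _*ℚ_ (fromℕ-normal m) (fromℕ-normal n)))

fromℕ-^ : ∀ m n → fromℕ (m ^ n) ≡ fromℕ m ^ℚ n
fromℕ-^ m zero    = refl
fromℕ-^ m (suc n) = trans (fromℕ-* m (m ^ n)) (cong (fromℕ m *ℚ_) (fromℕ-^ m n))

fromℕ-inverse : ∀ n → fromℕ (suc n) *ℚ (ℤ.+ 1 /ℚ suc n) ≡ 1ℚ
fromℕ-inverse n = begin
  fromℕ (suc n) *ℚ (ℤ.+ 1 /ℚ suc n)     ≡⟨ cong₂ _*ℚ_ (fromℕ-normal (suc n)) (ℚ.normalize-coprime (1-coprimeTo (suc n))) ⟩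
  (ℤ.+ suc n ℤ.* ℤ.+ 1) /ℚ (1 * suc n)  ≡⟨ ℚ./-cong (ℤ.*-identityʳ (ℤ.+ suc n)) (ℕ.*-identityˡ (suc n)) ⟩
  ℤ.+ suc n /ℚ suc n                    ≡⟨ ℚ.fromℚᵘ-cong {mkℚᵘ (ℤ.+ suc n) n} {mkℚᵘ (ℤ.+ 1) 0} (*≡* (ℤ.*-comm (ℤ.+ suc n) (ℤ.+ 1))) ⟩
  1ℚ                                    ∎
  where open ≡-Reasoning

euler-fromℕ : ∀ n → euler (fromℕ (suc n)) n ≡ fromℕ (2 ^ suc n)
euler-fromℕ n = trans (cong (λ y → (1ℚ ℚ.+ y) ^ℚ suc n) (fromℕ-inverse n)) (sym (fromℕ-^ 2 (suc n)))

-- A single Euler term suffices: at y = n + 1 its base 1 + y / (n + 1) is 2, so 2 ^ (n + 1) is an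
-- approximant of e ^ (n + 1) from below. Using base 2 costs only a constant factor.
log-upper : ∀ {X} n → X < fromℕ (2 ^ suc n) → fromℕ (suc n) ∈ upper (log X)
log-upper {X} n X< = fromℕ-≥0 (suc n) , n , subst (X <_) (sym (euler-fromℕ n)) X<

floor-spec : ∀ X → 0ℚ < X → ∃[ n ] (floor X ≡ ℤ.+ n × fromℕ n ≤ X × X < fromℕ (suc n))
floor-spec X@(mkℚ -[1+ a ] d c) 0<X = contradiction (ℚ.<-trans 0<X (ℚ.negative⁻¹ X)) (ℚ.<-irrefl refl)
floor-spec (mkℚ (ℤ.+ a) d c) _ = n , div-pos-is-/ℕ (ℤ.+ a) (suc d) , n≤X , X<
  where
  n = a / suc d
  n≤X : fromℕ n ≤ mkℚ (ℤ.+ a) d c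
  n≤X = subst (_≤ mkℚ (ℤ.+ a) d c) (sym (fromℕ-normal n)) (*≤* (begin
    ℤ.+ n ℤ.* ℤ.+ suc d  ≡⟨ ℤ.pos-* n (suc d) ⟨
    ℤ.+ (n * suc d)      ≤⟨ ℤ.+≤+ (m/n*n≤m a (suc d)) ⟩
    ℤ.+ a                ≡⟨ ℤ.*-identityʳ (ℤ.+ a) ⟨
    ℤ.+ a ℤ.* ℤ.+ 1      ∎))
    where open ℤ.≤-Reasoning
  X< : mkℚ (ℤ.+ a) d c < fromℕ (suc n)
  X< = subst (mkℚ (ℤ.+ a) d c <_) (sym (fromℕ-normal (suc n))) (*<* (begin-strict
    ℤ.+ a ℤ.* ℤ.+ 1              ≡⟨ ℤ.*-identityʳ (ℤ.+ a) ⟩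
    ℤ.+ a                        ≡⟨ cong ℤ.+_ (m≡m%n+[m/n]*n a (suc d)) ⟩
    ℤ.+ (a % suc d + n * suc d)  <⟨ ℤ.+<+ (ℕ.+-monoˡ-< (n * suc d) (m%n<n a (suc d))) ⟩
    ℤ.+ (suc n * suc d)          ≡⟨ ℤ.pos-* (suc n) (suc d) ⟩
    ℤ.+ suc n ℤ.* ℤ.+ suc d      ∎))
    where open ℤ.≤-Reasoning

-- Witnesses for the cuts: the numerator c b, the denominator b > (log X) ^ (m / n), the constant E and
-- 2 ^ J < √ X.
quotient-bound : ∀ {X c J E m n b} .{{_ : NonZero n}} → 0 <ℕ b → fromℕ b ∈ upper (log X ^[ m / n ]) →
                 fromℕ (2 ^ (J + J)) < X → c * b <ℕ E * 2 ^ J →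
                 natural c ≤ᶜ (rational (fromℕ (suc E)) *ᶜ √ X) ÷ᶜ (log X ^[ m / n ])
quotient-bound {X} {c} {J} {E} {m} {n} {b} 0<b b∈ 4^J<X cb< {q} q<c = inj₂
  (fromℕ (c * b) , fromℕ b , cb∈ , b∈ , fromℕ-≥0 (c * b) ,
   subst (q *ℚ fromℕ b <_) (sym (fromℕ-* c b))
     (ℚ.*-monoˡ-<-pos (fromℕ b) {{ℚ.positive (fromℕ-mono-< {0} {b} 0<b)}} q<c))
  where
  cb∈ : fromℕ (c * b) ∈ lower (rational (fromℕ (suc E)) *ᶜ √ X)
  cb∈ = inj₂ (fromℕ E , fromℕ (2 ^ J) , fromℕ-mono-< (ℕ.n<1+n E) ,
    inj₂ (subst (_< X) (trans (cong fromℕ (ℕ.^-distribˡ-+-* 2 J J)) (fromℕ-* (2 ^ J) (2 ^ J))) 4^J<X) ,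
    fromℕ-≥0 E , fromℕ-≥0 (2 ^ J) ,
    subst (fromℕ (c * b) <_) (fromℕ-* E (2 ^ J)) (fromℕ-mono-< cb<))

log-power-upper : ∀ {X} n κ b K → X < fromℕ (2 ^ suc n) → suc n ^ κ <ℕ b ^ suc K →
                  fromℕ b ∈ upper (log X ^[ κ / suc K ])
log-power-upper {X} n κ b K X< n^κ<b^K = fromℕ-≥0 b , fromℕ (suc n) , log-upper n X< ,
  subst₂ _<_ (fromℕ-^ (suc n) κ) (fromℕ-^ b (suc K)) (fromℕ-mono-< n^κ<b^K)

theorem1p2 : (k : ℕ) → 2 ≤ℕ k →
    Σ[ A ∈ Pred ℕ 0ℓ ] Σ[ A? ∈ Decidable A ]
    ((A ^ˢ k) +ˢ A ≐ U
    × Σ[ C ∈ ℚ ] (0ℚ < C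
    × Σ[ X₀ ∈ ℚ ] ((X : ℚ) → 0ℚ < X → X₀ ≤ X →
    natural (count A? X)
    ≤ᶜ (rational C *ᶜ √ X) ÷ᶜ (log X ^[ k ∸ 2 / suc k ]))))
theorem1p2 (suc zero)    (s≤s ())
theorem1p2 (suc (suc κ)) _ = A , A? , ((λ _ → tt) , λ {n} _ → A^+A n) ,
  fromℕ (suc E) , fromℕ-mono-< {0} {suc E} (s≤s z≤n) , fromℕ 2 , bound
  where
  open Construction κ
  -- The 4 comes from b = 4 · 2 ^ s below. The successor makes `count<` strict, and C = E + 1 places
  -- E strictly below C.
  E : ℕ
  E = suc (4 * countConstant)
  bound : (X : ℚ) → 0ℚ < X → fromℕ 2 ≤ X →
          natural (count A? X) ≤ᶜ (rational (fromℕ (suc E)) *ᶜ √ X) ÷ᶜ (log X ^[ κ / 3 + κ ])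
  bound X 0<X 2≤X = fromFloor (floor-spec X 0<X)
    where
    fromFloor : ∃[ n ] (floor X ≡ ℤ.+ n × fromℕ n ≤ X × X < fromℕ (suc n)) →
                natural (count A? X) ≤ᶜ (rational (fromℕ (suc E)) *ᶜ √ X) ÷ᶜ (log X ^[ κ / 3 + κ ])
    -- The `suc` turns the bracket into 4 ^ J < n ≤ 4 ^ (J + 1), so that 2 ^ J lies strictly below √
    -- X. Starting at J = 0 takes n ≥ 2, which is why X₀ = 2.
    fromFloor (n , floor≡ , n≤X , X<) = fromScale (bracket (λ J → suc (2 ^ (J + J))) 0 n 2≤n n<)
      where
      2≤n : 2 ≤ℕ n
      2≤n = ℕ.s≤s⁻¹ (fromℕ-cancel-< (ℚ.≤-<-trans 2≤X X<))
      n< : n <ℕ suc (2 ^ (n + 0 + (n + 0)))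
      n< = s≤s (ℕ.≤-trans (ℕ.<⇒≤ (n<2^n n)) (ℕ.^-monoʳ-≤ 2 (ℕ.≤-trans (ℕ.m≤m+n n 0) (ℕ.m≤m+n (n + 0) (n + 0)))))
      fromScale : ∃[ J ] (0 ≤ℕ J × suc (2 ^ (J + J)) ≤ℕ n × n <ℕ suc (2 ^ (suc J + suc J))) →
                  natural (count A? X) ≤ᶜ (rational (fromℕ (suc E)) *ᶜ √ X) ÷ᶜ (log X ^[ κ / 3 + κ ])
      fromScale (J , _ , 4^J<n , n≤) = subst
        (λ z → natural (countℤ A? z) ≤ᶜ (rational (fromℕ (suc E)) *ᶜ √ X) ÷ᶜ (log X ^[ κ / 3 + κ ]))
        (sym floor≡)
        (quotient-bound {X} {c} {J} {E} {κ} {3 + κ} {b} (ℕ.m^n>0 2 (2 + s))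
          (log-power-upper (2 + (J + J)) κ b (2 + κ) X<2^ power<)
          (ℚ.<-≤-trans (fromℕ-mono-< 4^J<n) n≤X) count<)
        where
        open ℕ.≤-Reasoning
        s = saving κ J
        -- The exponent is that of `saving-double` for the bound 3 + 2J on log X.
        b = 2 ^ (2 + s)
        c = length (filter A? (applyUpTo suc n))
        X<2^ : X < fromℕ (2 ^ (3 + (J + J)))
        X<2^ = ℚ.<-≤-trans X< (fromℕ-mono-≤ (begin
          suc n                                    ≤⟨ ℕ.+-mono-≤ (ℕ.m^n>0 2 (suc J + suc J)) (ℕ.s≤s⁻¹ n≤) ⟩
          2 ^ (suc J + suc J) + 2 ^ (suc J + suc J)  ≡⟨ double J ⟩
          2 ^ (3 + (J + J))                        ∎))
          where
          double : ∀ J → 2 ^ (suc J + suc J) + 2 ^ (suc J + suc J) ≡ 2 ^ (3 + (J + J))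
          double J = trans (cong (λ z → 2 ^ suc z + 2 ^ suc z) (ℕ.+-suc J J)) (eq (2 ^ (2 + (J + J))))
            where
            eq : ∀ x → x + x ≡ 2 * x
            eq = solve-∀
        power< : (3 + (J + J)) ^ κ <ℕ b ^ (3 + κ)
        power< = begin-strict
          (3 + (J + J)) ^ κ       <⟨ saving-double κ {3 + (J + J)} {J} (ℕ.≤-trans (ℕ.n≤1+n _) (ℕ.≤-reflexive (eq J))) ⟩
          2 ^ ((2 + s) * (3 + κ)) ≡⟨ ℕ.^-*-assoc 2 (2 + s) (3 + κ) ⟨
          b ^ (3 + κ)             ∎
          where
          eq : ∀ J → 4 + (J + J) ≡ 2 * (2 + J)
          eq = solve-∀
        count< : c * b <ℕ E * 2 ^ J
        count< = begin-strict
          c * b                                  ≡⟨ regroup c (2 ^ s) ⟩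
          4 * (c * 2 ^ s)                        ≤⟨ ℕ.*-monoʳ-≤ 4 (count-bound J (ℕ.s≤s⁻¹ n≤)) ⟩
          4 * (countConstant * 2 ^ J)            ≡⟨ ℕ.*-assoc 4 countConstant (2 ^ J) ⟨
          4 * countConstant * 2 ^ J              <⟨ ℕ.*-monoˡ-< (2 ^ J) {{ℕ.m^n≢0 2 J}} (ℕ.n<1+n (4 * countConstant)) ⟩
          E * 2 ^ J                              ∎
          where
          regroup : ∀ c x → c * (2 * (2 * x)) ≡ 4 * (c * x)
          regroup = solve-∀
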